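{- Let $L\subseteq\{2,3,4,\ldots\}$ be any non-empty set, and let $\varepsilon>0$. Then there exists a finite subset $L'\subseteq L$ with $\langle L'\rangle=\langle L\rangle$ such that $$\max\nolimits_{L'}(G,w)\ \ge\ (1-\varepsilon)\cdot\max\nolimits_{L}(G,w)$$ for all complete graphs $G$ whose number of vertices is in $\langle L\rangle$ and all edge weights $w:E\to\mathbb{N}$ of $G$ (not necessarily satisfying the triangle inequality). Here $G$ ranges over directed complete graphs and, in the case $L\subseteq\{3,4,5,\ldots\}$, also over undirected complete graphs.
   Context: $\mathbb{N}$ denotes the natural numbers including $0$. A directed complete graph has an edge $(u,v)$ for every ordered pair of distinct vertices. A cycle cover of a directed graph $G=(V,E)$ is a set $C\subseteq E$ such that every vertex has exactly one incoming and exactly one outgoing edge in $C$. A cycle cover of an undirected simple graph $G=(V,E)$ is a set $C\subseteq E$ such that every vertex is incident to exactly two edges of $C$. In both cases $(V,C)$ is a disjoint union of cycles; the length of a cycle is its number of edges. An $L$-cycle cover is a cycle cover all of whose cycles have length in $L$, where $L\subseteq\{2,3,4,\ldots\}$ for directed graphs and $L\subseteq\{3,4,5,\ldots\}$ for undirected graphs. For $C\subseteq E$, $w(C)=\sum_{e\in C}w(e)$. $\max_L(G,w)$ is the weight of a maximum-weight $L$-cycle cover of $G$ with edge weights $w$. $\langle L\rangle$ is the set of all $n$ for which there exist $k\ge 1$ and (not necessarily distinct) $\lambda_1,\ldots,\lambda_k\in L$ with $\sum_{i=1}^k\lambda_i=n$; a complete graph on $n$ vertices has an $L$-cycle cover if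 and only if $n\in\langle L\rangle$. -}

module Defs where

open import Level using (0ℓ)
open import Data.Bool.Base using (Bool; T; if_then_else_; _∧_)
open import Data.Fin.Base using (Fin; toℕ)
open import Data.Fin.Subset using (∣_∣)
open import Data.List.Base using (List; []; _∷_; _∷ʳ_; length)
open import Data.List.Relation.Unary.All using (All)
open import Data.List.Relation.Unary.Linked using (Linked)
open import Data.List.Relation.Unary.Unique.Propositional using (Unique)
open import Data.Nat.Base using (ℕ; _≤_; _<ᵇ_)
import Data.Nat.ListAction as List
open import Data.Nat.Properties using (+-0-commutativeMonoid)
open import Data.Product.Base using (∃; _×_)
open import Data.Product using (∃!)
open import Data.Vec.Base using (tabulate)
open import Relation.Binary.Core using (Rel)
open import Relation.Binary.PropositionalEquality using (_≡_; _≢_)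
open import Relation.Unary using (Pred)
open import Algebra.Properties.CommutativeMonoid.Sum +-0-commutativeMonoid
  using (sum-syntax)

⟨_⟩ : Pred ℕ 0ℓ → Pred ℕ 0ℓ
⟨ L ⟩ n = ∃ λ λs → λs ≢ [] × All L λs × List.sum λs ≡ n

-- The complete graph on n vertices has vertex set Fin n.  An edge set is given
-- by its adjacency matrix: an arc (u , v) is the entry at u v, an undirected
-- edge {u , v} is the pair of entries at u v and v u.  Both kinds of edge join
-- distinct vertices, so the diagonal has to be empty.

EdgeSet : ℕ → Set
EdgeSet n = Fin n → Fin n → Bool

-- Edge weights; the diagonal corresponds to no edge and is never used.

Weights : ℕ → Set
Weights n = Fin n → Fin n → ℕ

module _ {n : ℕ} (C : EdgeSet n) where

  Edge : Rel (Fin n) 0ℓ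
  Edge u v = T (C u v)

  -- The cycle x → x₁ → … → xₖ → x, where xs = x₁ ∷ … ∷ xₖ.  As its vertices are
  -- distinct, its number of edges is length (x ∷ xs), apart from undirected
  -- walks x — x₁ — x, which are excluded in IsUndirectedLCycleCover.

  IsCycle : Fin n → List (Fin n) → Set
  IsCycle x xs = Unique (x ∷ xs) × Linked Edge (x ∷ xs ∷ʳ x)

  record IsDirectedLCycleCover (L : Pred ℕ 0ℓ) : Set where
    field
      edges-proper : ∀ {u v} → Edge u v → u ≢ v
      one-outgoing : ∀ u → ∃! _≡_ λ v → Edge u v
      one-incoming : ∀ v → ∃! _≡_ λ u → Edge u v
      lengths      : ∀ x xs → IsCycle x xs → L (length (x ∷ xs))

  record IsUndirectedLCycleCover (L : Pred ℕ 0ℓ) : Set where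
    field
      edges-proper : ∀ {u v} → Edge u v → u ≢ v
      symmetric    : ∀ u v → C u v ≡ C v u
      two-incident : ∀ u → ∣ tabulate (C u) ∣ ≡ 2
      lengths      : ∀ x xs → 3 ≤ length (x ∷ xs) →
                     IsCycle x xs → L (length (x ∷ xs))

  directedWeight : Weights n → ℕ
  directedWeight w = ∑[ u < n ] ∑[ v < n ] (if C u v then w u v else 0)

  -- Each edge {u , v} is counted once, from its smaller endpoint.

  undirectedWeight : Weights n → ℕ
  undirectedWeight w =
    ∑[ u < n ] ∑[ v < n ] (if (toℕ u <ᵇ toℕ v) ∧ C u v then w u v else 0)

IsMaximum : {A : Set} → Pred A 0ℓ → (A → ℕ) → Pred ℕ 0ℓ
IsMaximum P f m = (∃ λ x → P x × f x ≡ m) × (∀ x → P x → f x ≤ m)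

-- "max_L(G, w) = m"; this includes the existence of an L-cycle cover.

IsDirectedMax : Pred ℕ 0ℓ → (n : ℕ) → Weights n → Pred ℕ 0ℓ
IsDirectedMax L n w =
  IsMaximum (λ (C : EdgeSet n) → IsDirectedLCycleCover C L)
            (λ C → directedWeight C w)

IsUndirectedMax : Pred ℕ 0ℓ → (n : ℕ) → Weights n → Pred ℕ 0ℓ
IsUndirectedMax L n w =
  IsMaximum (λ (C : EdgeSet n) → IsUndirectedLCycleCover C L)
            (λ C → undirectedWeight C w)

{-# OPTIONS --safe #-}
module Submission where

open import Defs
open import Level using (0ℓ)
open import Axiom.ExcludedMiddle using (ExcludedMiddle)
open import Data.Integer.Base using (+_)
open import Data.List.Base using (List)
open import Data.List.Membership.Propositional using (_∈_)
open import Data.Nat.Base using (ℕ) renaming (_≤_ to _≤ⁿ_)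
open import Data.Product.Base using (∃; ∃₂; _×_)
open import Data.Rational.Base using (ℚ; 0ℚ; 1ℚ; _/_; _-_; _*_; _<_; _≥_)
open import Relation.Binary.PropositionalEquality using (_≡_)
open import Relation.Unary using (Pred; Satisfiable; _⊆_; _≐_)

open import Data.Bool.Base using (Bool; true; false; T; if_then_else_; _∧_; _∨_)
open import Data.Bool.Properties using (T?; T-∨; T-∧; ∨-comm)
open import Data.Empty using (⊥-elim)
open import Data.Fin.Base using (Fin; zero; suc; toℕ)
open import Data.Fin.Properties using (_≟_; ¬∀⟶∃¬; toℕ-injective) renaming (all? to allFin?)
open import Data.Fin.Subset using (∣_∣)
import Data.Integer.Base as ℤ
import Data.Integer.Properties as ℤ
open import Data.Integer.Tactic.RingSolver using (solve-∀)
open import Data.List.Base as List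
  using ([]; _∷_; _++_; _∷ʳ_; length; map; concatMap; filter; take; allFin;
         applyUpTo; upTo; cartesianProduct; replicate)
open import Data.List.Membership.Propositional using (_∉_; find; lose)
open import Data.List.Membership.Propositional.Properties
open import Data.List.Membership.Propositional.Properties.WithK using (unique∧set⇒bag)
open import Data.List.NonEmpty.Base as List⁺ using (List⁺; _∷_; toList)
open import Data.List.Properties
  using (length-++; length-replicate; length-tabulate; length-applyUpTo; map-++; map-∘; map-cong;
         map-tabulate; map-applyUpTo; applyUpTo-∷ʳ; ++-assoc; ++-identityʳ; concatMap-++)
open import Data.List.Relation.Binary.BagAndSetEquality using (∼bag⇒↭)
open import Data.List.Relation.Binary.Permutation.Propositional
  using (_↭_; ↭-refl; ↭-sym; ↭-trans; ↭-reflexive; ↭⇒↭ₛ; module PermutationReasoning)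
open import Data.List.Relation.Binary.Permutation.Propositional.Properties as ↭
  using (∈-resp-↭; ↭-length; ∷↭∷ʳ)
open import Data.List.Relation.Binary.Permutation.Setoid.Properties using (Unique-resp-↭)
open import Data.List.Relation.Unary.All as All using (All; []; _∷_)
import Data.List.Relation.Unary.All.Properties as All
open import Data.List.Relation.Unary.AllPairs using ([]; _∷_)
open import Data.List.Relation.Unary.Any using (here; there)
open import Data.List.Relation.Unary.Linked using (Linked; []; [-]; _∷_)
open import Data.List.Relation.Unary.Unique.Propositional using (Unique)
import Data.List.Relation.Unary.Unique.Propositional.Properties as Unique
open import Data.Nat.Base as ℕ
  using (zero; suc; pred; z≤n; s≤s; _+_; _∸_; _⊔_; _<ᵇ_; NonZero)
  renaming (_*_ to _*ⁿ_; _<_ to _<ⁿ_)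
open import Data.Nat.DivMod using (_%_; m≡m%n+[m/n]*n; /-monoˡ-≤; m%n<n) renaming (_/_ to _÷_)
open import Data.Nat.ListAction using (sum)
open import Data.Nat.ListAction.Properties using (sum-++; sum-↭)
import Data.Nat.Properties as ℕ
open import Data.Product.Base using (_,_; proj₁; proj₂; uncurry)
open import Data.Product.Properties using (≡-dec)
import Data.Rational.Base as ℚ
import Data.Rational.Properties as ℚ
import Data.Rational.Unnormalised.Base as ℚᵘ
import Data.Rational.Unnormalised.Properties as ℚᵘ
open import Data.Sum.Base using (_⊎_; inj₁; inj₂; [_,_]′)
open import Data.Unit.Base using (tt)
import Data.Vec.Base as Vec
open import Function.Base using (_∘_; id; const)
open import Function.Bundles using (mk⇔; Equivalence)
open import Relation.Binary.Definitions using (tri<; tri≈; tri>)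
open import Relation.Binary.PropositionalEquality
  using (_≢_; refl; sym; trans; cong; cong₂; subst; subst₂; setoid; _≗_; module ≡-Reasoning)
open import Relation.Nullary.Decidable using (yes; no; ⌊_⌋; toWitness; fromWitness)
open import Relation.Nullary.Negation using (contradiction)
open import Algebra.Properties.CommutativeMonoid.Sum ℕ.+-0-commutativeMonoid using (sum-syntax)
import Algebra.Properties.CommutativeSemigroup ℕ.+-commutativeSemigroup as +
import Algebra.Properties.CommutativeSemigroup ℕ.*-commutativeSemigroup as *

-- Let ε ≥ 1/q.  If every element of L is below 2q, take L′ = L.  Otherwise fix d ∈ L
-- with d ≥ 2q and, for every residue mod d attained on L, an element of L attaining
-- it; L′ consists of the elements of L up to a bound N exceeding all of these.  A
-- cycle length y ∈ L with y > N is x + j d for some such x, so the cycle can be cut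
-- into j + 1 cycles with lengths in L′, where (j + 1) q ≤ y because (j + 1) d ≤ 2 y.
-- Averaged over the y starting points of the cut, the j + 1 lost arcs weigh
-- (j + 1) / y ≤ 1/q of the cycle.  An undirected cover is treated by orienting its
-- cycles.

-- Cutting a long cycle into shorter ones costs little weight if the pieces are long on average.
-- Suppose a cycle of length p is cut into at most p / q pieces and each piece is closed up by an
-- arc, of which only nonnegative weight is used. Over the p rotations of the cut every arc is lost
-- once per piece (`total-loss`), so some rotation loses at most a fraction 1 / q of the weight
-- (`cut-cycle`).
--
-- It remains to find finitely many lengths such that every longer element of `L` is a sum of few of
-- them. Modulo a large d in `L` there are finitely many residues, so beyond some threshold every
-- element of `L` is a smaller element of `L` plus a multiple of d (`split-threshold`). Splitting
-- the summands in this way gives `⟨L′⟩≐⟨L⟩`; splitting the cycles of an optimal `L`-cover gives an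
-- `L′`-cover of nearly the same weight (`refine`).
--
-- Cutting is done on lists of cycles (`LCycles`). Covers given as edge sets are taken apart by
-- `cycle-decomposition` and rebuilt in `DirectedCover` and `UndirectedCover`. The link between the
-- two views is that the vertex set of a cycle in a cover is closed under edges, so every cycle of
-- the edge set has the same vertices as a listed one.

private
  variable
    A B : Set
    n : ℕ

-- Duplicate-free lists and permutations

unique-map-injective : (f : A → B) {xs : List A} → Unique (map f xs) →
                       ∀ {x y} → x ∈ xs → y ∈ xs → f x ≡ f y → x ≡ y
unique-map-injective f (_ ∷ _)  (here refl) (here refl) _  = refl
unique-map-injective f (px ∷ _) (here refl) (there q)   eq =
  contradiction eq (All.lookup px (∈-map⁺ f q))
unique-map-injective f (px ∷ _) (there p)   (here refl) eq =
  contradiction (sym eq) (All.lookup px (∈-map⁺ f p))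
unique-map-injective f (_ ∷ u)  (there p)   (there q)   eq =
  unique-map-injective f u p q eq

unique-map⁺ : (f : A → B) {xs : List A} → Unique xs →
              (∀ {x y} → x ∈ xs → y ∈ xs → f x ≡ f y → x ≡ y) → Unique (map f xs)
unique-map⁺ f []       inj = []
unique-map⁺ f (px ∷ u) inj =
  All.map⁺ (All.tabulate λ y∈ eq → All.lookup px y∈ (inj (here refl) (there y∈) eq))
  ∷ unique-map⁺ f u (λ x∈ y∈ → inj (there x∈) (there y∈))

unique-resp-↭ : {xs ys : List A} → xs ↭ ys → Unique xs → Unique ys
unique-resp-↭ {A = A} p = Unique-resp-↭ (setoid A) (↭⇒↭ₛ p)

unique-++⁻ˡ : ∀ xs {ys : List A} → Unique (xs ++ ys) → Unique xs
unique-++⁻ˡ []       u        = []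
unique-++⁻ˡ (x ∷ xs) (px ∷ u) = All.++⁻ˡ xs px ∷ unique-++⁻ˡ xs u

unique-++⁻ʳ : ∀ xs {ys : List A} → Unique (xs ++ ys) → Unique ys
unique-++⁻ʳ []       u       = u
unique-++⁻ʳ (x ∷ xs) (_ ∷ u) = unique-++⁻ʳ xs u

unique∧⊆∧⊇⇒↭ : {xs ys : List A} → Unique xs → Unique ys →
               (∀ {v} → v ∈ xs → v ∈ ys) → (∀ {v} → v ∈ ys → v ∈ xs) → xs ↭ ys
unique∧⊆∧⊇⇒↭ uxs uys f g = ∼bag⇒↭ (unique∧set⇒bag uxs uys (mk⇔ f g))

-- Pigeonhole: appending the missing vertices turns `xs` into a permutation of all `n`. This bounds
-- every search for a cycle.
unique-length≤ : {xs : List (Fin n)} → Unique xs → length xs ≤ⁿ n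
unique-length≤ {n} {xs} u = begin
  length xs                  ≤⟨ ℕ.m≤m+n _ _ ⟩
  length xs + length rest    ≡⟨ length-++ xs ⟨
  length (xs ++ rest)        ≡⟨ ↭-length perm ⟩
  length (allFin n)          ≡⟨ length-tabulate id ⟩
  n                          ∎
  where
  open ℕ.≤-Reasoning
  open import Data.List.Membership.DecPropositional (_≟_ {n}) using (_∉?_; _∈?_)
  rest = filter (_∉? xs) (allFin n)
  back : ∀ {v} → v ∈ allFin n → v ∈ xs ++ rest
  back {v} v∈ with v ∈? xs
  ... | yes p = ∈-++⁺ˡ p
  ... | no ¬p = ∈-++⁺ʳ xs (∈-filter⁺ (_∉? xs) v∈ ¬p)
  perm : xs ++ rest ↭ allFin n
  perm = unique∧⊆∧⊇⇒↭
    (Unique.++⁺ u (Unique.filter⁺ (_∉? xs) (Unique.allFin⁺ n))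
      (λ (p , q) → proj₂ (∈-filter⁻ (_∉? xs) {xs = allFin n} q) p))
    (Unique.allFin⁺ n) (λ {v} _ → ∈-allFin v) back

-- Cycles as lists and their arcs

steps : List A → List (A × A)
steps []           = []
steps (x ∷ [])     = []
steps (x ∷ y ∷ ys) = (x , y) ∷ steps (y ∷ ys)

-- x ∷ xs stands for the cycle from x through xs back to x.

arcs : List⁺ A → List (A × A)
arcs (x ∷ xs) = steps (x ∷ xs ∷ʳ x)

vertices : List (List⁺ A) → List A
vertices = concatMap toList

allArcs : List (List⁺ A) → List (A × A)
allArcs = concatMap arcs

steps-++ : ∀ xs (y : A) ys → steps (xs ++ y ∷ ys) ≡ steps (xs ∷ʳ y) ++ steps (y ∷ ys)
steps-++ []            y ys = refl
steps-++ (x ∷ [])      y ys = refl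
steps-++ (x ∷ x′ ∷ xs) y ys = cong (_ ∷_) (steps-++ (x′ ∷ xs) y ys)

steps-sources : ∀ xs (y : A) → map proj₁ (steps (xs ∷ʳ y)) ≡ xs
steps-sources []            y = refl
steps-sources (x ∷ [])      y = refl
steps-sources (x ∷ x′ ∷ xs) y = cong (x ∷_) (steps-sources (x′ ∷ xs) y)

steps-targets : ∀ (x : A) xs → map proj₂ (steps (x ∷ xs)) ≡ xs
steps-targets x []       = refl
steps-targets x (y ∷ xs) = cong (y ∷_) (steps-targets y xs)

arcs-sources : (c : List⁺ A) → map proj₁ (arcs c) ≡ toList c
arcs-sources (x ∷ xs) = steps-sources (x ∷ xs) x

arcs-targets : (c : List⁺ A) → map proj₂ (arcs c) ↭ toList c
arcs-targets (x ∷ xs) =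
  ↭-trans (↭-reflexive (steps-targets x (xs ∷ʳ x))) (↭-sym (∷↭∷ʳ x xs))

allArcs-sources : (cs : List (List⁺ A)) → map proj₁ (allArcs cs) ≡ vertices cs
allArcs-sources []       = refl
allArcs-sources (c ∷ cs) =
  trans (map-++ proj₁ (arcs c) (allArcs cs)) (cong₂ _++_ (arcs-sources c) (allArcs-sources cs))

allArcs-targets : (cs : List (List⁺ A)) → map proj₂ (allArcs cs) ↭ vertices cs
allArcs-targets []       = ↭-refl
allArcs-targets (c ∷ cs) =
  ↭-trans (↭-reflexive (map-++ proj₂ (arcs c) (allArcs cs)))
          (↭.++⁺ (arcs-targets c) (allArcs-targets cs))

target∈ : (c : List⁺ A) {u v : A} → (u , v) ∈ arcs c → v ∈ toList c
target∈ c p = ∈-resp-↭ (arcs-targets c) (∈-map⁺ proj₂ p)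

source⇒arc : (c : List⁺ A) {u : A} → u ∈ toList c → ∃ λ v → (u , v) ∈ arcs c
source⇒arc c u∈ with ∈-map⁻ proj₁ (subst (_ ∈_) (sym (arcs-sources c)) u∈)
... | (_ , v) , p , refl = v , p

∈-allArcs : ∀ {cs} {c : List⁺ A} {a} → c ∈ cs → a ∈ arcs c → a ∈ allArcs cs
∈-allArcs c∈ a∈ = ∈-concatMap⁺ arcs (lose c∈ a∈)

-- The arcs fall into those from `x` to `u` and those from `u` back to `x`; starting at `u` only
-- swaps the two blocks.
rotate-to : (c : List⁺ A) {u : A} → u ∈ toList c →
            ∃ λ xs → u ∷ xs ↭ toList c × arcs (u ∷ xs) ↭ arcs c
rotate-to (x ∷ xs) (here refl) = xs , ↭-refl , ↭-refl
rotate-to (x ∷ xs) {u} (there u∈) with ∈-∃++ u∈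
... | ys , zs , refl = zs ++ x ∷ ys , ↭.++-comm (u ∷ zs) (x ∷ ys) , (begin
    steps (u ∷ (zs ++ x ∷ ys) ∷ʳ u)                      ≡⟨ cong (λ l → steps (u ∷ l)) (++-assoc zs (x ∷ ys) _) ⟩
    steps ((u ∷ zs) ++ x ∷ ys ∷ʳ u)                      ≡⟨ steps-++ (u ∷ zs) x (ys ∷ʳ u) ⟩
    steps (u ∷ zs ∷ʳ x) ++ steps (x ∷ ys ∷ʳ u)           ↭⟨ ↭.++-comm (steps (u ∷ zs ∷ʳ x)) _ ⟩
    steps (x ∷ ys ∷ʳ u) ++ steps (u ∷ zs ∷ʳ x)           ≡⟨ steps-++ (x ∷ ys) u (zs ∷ʳ x) ⟨
    steps ((x ∷ ys) ++ u ∷ zs ∷ʳ x)                      ≡⟨ cong (λ l → steps (x ∷ l)) (++-assoc ys (u ∷ zs) _) ⟨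
    steps (x ∷ (ys ++ u ∷ zs) ∷ʳ x)                      ∎)
  where open PermutationReasoning

successor : (c : List⁺ A) → Unique (toList c) → 1 ≤ⁿ length (List⁺.tail c) →
            ∀ {u} → u ∈ toList c → ∃ λ b → u ≢ b × (u , b) ∈ arcs c
successor c uniq len {u} u∈ with rotate-to c u∈
... | [] , p , _ = contradiction (ℕ.suc-injective (↭-length p)) (ℕ.<⇒≢ len)
... | b ∷ xs , p , q with unique-resp-↭ (↭-sym p) uniq
... | (u≢b ∷ _) ∷ _ = b , u≢b , ∈-resp-↭ q (here refl)

-- Rotated to start at `u`, the cycle has the successor of `u` in second place and the predecessor
-- in last place. With at least three vertices these places differ.
neighbours : (c : List⁺ A) → Unique (toList c) → 2 ≤ⁿ length (List⁺.tail c) →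
             ∀ {u} → u ∈ toList c → ∃₂ λ a b → a ≢ b × (a , u) ∈ arcs c × (u , b) ∈ arcs c
neighbours c uniq len {u} u∈ with rotate-to c u∈
... | []      , p , _ = contradiction (ℕ.suc-injective (↭-length p)) (ℕ.<⇒≢ (ℕ.<-trans (s≤s z≤n) len))
... | _ ∷ []  , p , _ = contradiction (ℕ.suc-injective (↭-length p)) (ℕ.<⇒≢ len)
... | b ∷ y ∷ ys , p , q with unique-resp-↭ (↭-sym p) uniq
... | _ ∷ (b∉ ∷ _)
  with ∈-map⁻ proj₂ (subst (u ∈_) (sym (steps-targets y (ys ∷ʳ u))) (∈-++⁺ʳ ys (here refl)))
... | (a , _) , a∈ , refl =
  a , b , (λ a≡b → All.lookup b∉ (subst (a ∈_) (steps-sources (y ∷ ys) u) (∈-map⁺ proj₁ a∈)) (sym a≡b))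
  , ∈-resp-↭ q (there (there a∈)) , ∈-resp-↭ q (here refl)

-- Decomposing an edge set into disjoint cycles

module _ (C : EdgeSet n) where

  Closed : Pred (List (Fin n)) 0ℓ
  Closed S = ∀ {u v} → Edge C u v → u ∈ S → v ∈ S

  linked-steps : ∀ {xs} → Linked (Edge C) xs → ∀ {u v} → (u , v) ∈ steps xs → Edge C u v
  linked-steps (e ∷ es) (here refl) = e
  linked-steps (e ∷ es) (there p)   = linked-steps es p

  steps-linked : ∀ xs → (∀ {u v} → (u , v) ∈ steps xs → Edge C u v) → Linked (Edge C) xs
  steps-linked []           f = []
  steps-linked (x ∷ [])     f = [-]
  steps-linked (x ∷ y ∷ ys) f = f (here refl) ∷ steps-linked (y ∷ ys) (f ∘ there)

  linked-within : ∀ {S x xs} → Closed S → Linked (Edge C) (x ∷ xs) → x ∈ S → All (_∈ S) (x ∷ xs)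
  linked-within cl [-]      x∈ = x∈ ∷ []
  linked-within cl (e ∷ es) x∈ = x∈ ∷ linked-within cl es (cl e x∈)

  linked-last : ∀ {S} xs {y u} → Closed S → Linked (Edge C) (xs ∷ʳ y) →
                u ∈ xs → u ∈ S → y ∈ S
  linked-last (x ∷ xs) cl es (here refl) u∈ =
    All.lookup (linked-within cl es u∈) (∈-++⁺ʳ (x ∷ xs) (here refl))
  linked-last (x ∷ x′ ∷ xs) cl (_ ∷ es) (there p) u∈ = linked-last (x′ ∷ xs) cl es p u∈

  -- From the common vertex the cycle runs inside `S` to its starting point (`linked-last`), and
  -- from there through all its vertices.
  cycle-within : ∀ {S x xs u} → Closed S → IsCycle C x xs → u ∈ x ∷ xs → u ∈ S →
                 All (_∈ S) (x ∷ xs)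
  cycle-within {x = x} {xs} cl (_ , es) u∈ u∈S =
    All.++⁻ˡ (x ∷ xs) (linked-within cl es (linked-last (x ∷ xs) cl es u∈ u∈S))

  -- Each cycle stays within the vertex set of the other, so their vertices agree. This transfers
  -- the length of a listed cycle to an arbitrary cycle of a cover.
  closed-cycles-same-length : ∀ {x xs y ys} → IsCycle C x xs → IsCycle C y ys →
    Closed (x ∷ xs) → Closed (y ∷ ys) → x ∈ y ∷ ys → length (x ∷ xs) ≡ length (y ∷ ys)
  closed-cycles-same-length {x} cyc cyc′ cl cl′ x∈ =
    ↭-length (unique∧⊆∧⊇⇒↭ (proj₁ cyc) (proj₁ cyc′)
      (All.lookup (cycle-within cl′ cyc (here refl) x∈))
      (All.lookup (cycle-within cl cyc′ x∈ (here refl))))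

  cycle-edges : ∀ {x xs} → IsCycle C x xs → ∀ {u v} → (u , v) ∈ arcs (x ∷ xs) → Edge C u v
  cycle-edges cyc = linked-steps (proj₂ cyc)

  -- The bound concerns the vertices after the first: `k = 2` means at least three vertices, `k = 0`
  -- is no restriction.
  IsLongCycle : ℕ → Pred (List⁺ (Fin n)) 0ℓ
  IsLongCycle k (x ∷ xs) = IsCycle C x xs × k ≤ⁿ length xs

  linked-prefix : ∀ xs {y ys} → Linked (Edge C) (xs ++ y ∷ ys) → Linked (Edge C) (xs ∷ʳ y)
  linked-prefix []           es       = [-]
  linked-prefix (x ∷ [])     (e ∷ es) = e ∷ [-]
  linked-prefix (x ∷ z ∷ zs) (e ∷ es) = e ∷ linked-prefix (z ∷ zs) es

  -- k = 0 serves directed graphs, k = 2 undirected ones, where a predecessor must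
  -- not lead straight back.

  module _ (k : ℕ)
    (predecessor : ∀ z ps → ∃ λ t → Edge C t z × t ∉ take k (z ∷ ps))
    (long-closed : ∀ {c} → IsLongCycle k c → Closed (toList c))
    where

    open import Data.List.Membership.DecPropositional (_≟_ {n}) using (_∈?_)

    ∈-take : ∀ j (xs : List (Fin n)) {t ys} → t ∉ take j (xs ++ t ∷ ys) → j ≤ⁿ length xs
    ∈-take zero    xs       t∉ = z≤n
    ∈-take (suc j) []       t∉ = contradiction (here refl) t∉
    ∈-take (suc j) (x ∷ xs) t∉ = s≤s (∈-take j xs (t∉ ∘ there))

    -- The walk `t ∷ vs` returns to `t` at its occurrence in `vs`, and the stretch before that is a
    -- cycle. As `t` is not among the first `k` entries, at least `k` vertices lie in between.
    close-cycle : ∀ {t vs} → Unique vs → Linked (Edge C) (t ∷ vs) → t ∉ take k vs → t ∈ vs →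
                  ∃ λ c → IsLongCycle k c × (∀ {v} → v ∈ toList c → v ∈ vs)
    close-cycle {t} u es t∉ t∈ with ∈-∃++ t∈
    ... | as , bs , refl =
      t ∷ as
      , ((unique-++⁻ˡ (t ∷ as) (unique-resp-↭ (↭.shift t as bs) u) , linked-prefix (t ∷ as) es)
        , ∈-take k as t∉)
      , λ { (here refl) → t∈ ; (there v∈) → ∈-++⁺ˡ v∈ }

    -- A path is extended backwards until it meets itself.

    cycle-outside : ∀ {S} → Closed S → ∀ fuel z ps → n <ⁿ fuel + length (z ∷ ps) →
      Unique (z ∷ ps) → Linked (Edge C) (z ∷ ps) → All (_∉ S) (z ∷ ps) →
      ∃ λ c → IsLongCycle k c × All (_∉ S) (toList c)
    -- Out of fuel, the path would have more than `n` distinct vertices.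
    cycle-outside cl zero z ps n< u es out = contradiction (unique-length≤ u) (ℕ.<⇒≱ n<)
    cycle-outside cl (suc fuel) z ps n< u es out with predecessor z ps
    ... | t , e , t∉ with t ∈? (z ∷ ps)
    ...   | no  t∉vs = cycle-outside cl fuel t (z ∷ ps)
              (subst (n <ⁿ_) (sym (ℕ.+-suc fuel (length (z ∷ ps)))) n<)
              (All.tabulate (λ { y∈ refl → t∉vs y∈ }) ∷ u) (e ∷ es)
              -- An edge leaving a vertex of `S` would end in `S`, so the new first vertex lies
              -- outside as well.
              ((λ t∈S → All.head out (cl e t∈S)) ∷ out)
    ...   | yes t∈vs with close-cycle u (e ∷ es) t∉ t∈vs
    ...     | c , cyc , c⊆ = c , cyc , All.tabulate (All.lookup out ∘ c⊆)

    full-or-missing : ∀ S → (∀ v → v ∈ S) ⊎ ∃ λ v → v ∉ S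
    full-or-missing S with allFin? (_∈? S)
    ... | yes all∈ = inj₁ all∈
    ... | no ¬all∈ = inj₂ (¬∀⟶∃¬ n _ (_∈? S) ¬all∈)

    -- The vertices covered so far form a closed set, so a further cycle can be found disjoint from
    -- them. It covers at least one new vertex, which pays for one unit of fuel.
    complete-cycles : ∀ fuel cs → n ≤ⁿ fuel + length (vertices cs) →
      Unique (vertices cs) → Closed (vertices cs) → All (IsLongCycle k) cs →
      ∃ λ cs → All (IsLongCycle k) cs × vertices cs ↭ allFin n
    complete-cycles fuel cs n≤ u cl cycs with full-or-missing (vertices cs)
    ... | inj₁ all∈ = cs , cycs
          , unique∧⊆∧⊇⇒↭ u (Unique.allFin⁺ n) (λ {v} _ → ∈-allFin v) (λ {v} _ → all∈ v)
    complete-cycles zero cs n≤ u cl cycs | inj₂ (x , x∉) =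
      contradiction (unique-length≤ (All.tabulate (λ { y∈ refl → x∉ y∈ }) ∷ u)) (ℕ.<⇒≱ (s≤s n≤))
    complete-cycles (suc fuel) cs n≤ u cl cycs | inj₂ (x , x∉)
      with cycle-outside cl n x [] (ℕ.≤-reflexive (ℕ.+-comm 1 n)) ([] ∷ []) [-] (x∉ ∷ [])
    ... | y ∷ ys , cyc , out = complete-cycles fuel ((y ∷ ys) ∷ cs) n≤′
          (Unique.++⁺ (proj₁ (proj₁ cyc)) u λ (p , q) → All.lookup out p q)
          (λ e u∈ → [ ∈-++⁺ˡ ∘ long-closed cyc e , ∈-++⁺ʳ (y ∷ ys) ∘ cl e ]′ (∈-++⁻ (y ∷ ys) u∈))
          (cyc ∷ cycs)
      where
      open ℕ.≤-Reasoning
      n≤′ : n ≤ⁿ fuel + length (vertices ((y ∷ ys) ∷ cs))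
      n≤′ = begin
        n                                                     ≤⟨ n≤ ⟩
        suc fuel + length (vertices cs)                       ≡⟨ ℕ.+-suc fuel _ ⟨
        fuel + suc (length (vertices cs))                     ≤⟨ ℕ.+-monoʳ-≤ fuel (s≤s (ℕ.m≤n+m _ (length ys))) ⟩
        fuel + suc (length ys + length (vertices cs))         ≡⟨ cong (λ l → fuel + suc l) (length-++ ys) ⟨
        fuel + length (vertices ((y ∷ ys) ∷ cs))                     ∎

    cycle-decomposition : ∃ λ cs → All (IsLongCycle k) cs × vertices cs ↭ allFin n
    cycle-decomposition = complete-cycles n [] (ℕ.m≤m+n n 0) [] (λ _ ()) []

-- Weights of edge sets as sums over arcs

Σ-allFin : ∀ n (g : Fin n → ℕ) → ∑[ u < n ] g u ≡ sum (map g (allFin n))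
Σ-allFin n g = trans (go n g) (cong sum (sym (map-tabulate id g)))
  where
  go : ∀ n (g : Fin n → ℕ) → ∑[ u < n ] g u ≡ sum (List.tabulate g)
  go zero    g = refl
  go (suc n) g = cong₂ _+_ refl (go n (g ∘ suc))

sum-cartesianProduct : ∀ (h : A → B → ℕ) xs ys →
  sum (map (λ x → sum (map (h x) ys)) xs) ≡ sum (map (uncurry h) (cartesianProduct xs ys))
sum-cartesianProduct h []       ys = refl
sum-cartesianProduct h (x ∷ xs) ys = sym (begin
  sum (map (uncurry h) (map (x ,_) ys ++ cartesianProduct xs ys))
    ≡⟨ cong sum (map-++ (uncurry h) (map (x ,_) ys) _) ⟩
  sum (map (uncurry h) (map (x ,_) ys) ++ map (uncurry h) (cartesianProduct xs ys))
    ≡⟨ sum-++ (map (uncurry h) (map (x ,_) ys)) _ ⟩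
  sum (map (uncurry h) (map (x ,_) ys)) + sum (map (uncurry h) (cartesianProduct xs ys))
    ≡⟨ cong₂ _+_ (cong sum (sym (map-∘ ys))) (sym (sum-cartesianProduct h xs ys)) ⟩
  sum (map (h x) ys) + sum (map (λ x → sum (map (h x) ys)) xs)
    ∎)
  where open ≡-Reasoning

sum-filter : ∀ (C : A → Bool) (w : A → ℕ) xs →
  sum (map (λ x → if C x then w x else 0) xs) ≡ sum (map w (filter (T? ∘ C) xs))
sum-filter C w []       = refl
sum-filter C w (x ∷ xs) with C x
... | true  = cong₂ _+_ refl (sum-filter C w xs)
... | false = sum-filter C w xs

-- The double sum is a sum over the pairs that are edges, listed without repetition; `as` is a
-- permutation of that list.
directedWeight-arcs : ∀ (C : EdgeSet n) (w : Weights n) {as} → Unique as →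
  (∀ {u v} → Edge C u v → (u , v) ∈ as) → (∀ {u v} → (u , v) ∈ as → Edge C u v) →
  directedWeight C w ≡ sum (map (uncurry w) as)
directedWeight-arcs {n} C w {as} uniq to from = begin
  directedWeight C w
    ≡⟨ Σ-allFin n _ ⟩
  sum (map (λ u → ∑[ v < n ] weight u v) (allFin n))
    ≡⟨ cong sum (map-cong (λ u → Σ-allFin n (weight u)) (allFin n)) ⟩
  sum (map (λ u → sum (map (weight u) (allFin n))) (allFin n))
    ≡⟨ sum-cartesianProduct weight (allFin n) (allFin n) ⟩
  sum (map (uncurry weight) pairs)
    ≡⟨ sum-filter (uncurry C) (uncurry w) pairs ⟩
  sum (map (uncurry w) (filter (T? ∘ uncurry C) pairs))
    ≡⟨ sum-↭ (↭.map⁺ (uncurry w) perm) ⟩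
  sum (map (uncurry w) as)
    ∎
  where
  open ≡-Reasoning
  weight : Fin n → Fin n → ℕ
  weight u v = if C u v then w u v else 0
  pairs = cartesianProduct (allFin n) (allFin n)
  perm : filter (T? ∘ uncurry C) pairs ↭ as
  perm = unique∧⊆∧⊇⇒↭
    (Unique.filter⁺ (T? ∘ uncurry C) (Unique.cartesianProduct⁺ (Unique.allFin⁺ n) (Unique.allFin⁺ n)))
    uniq
    (λ p → to (proj₂ (∈-filter⁻ (T? ∘ uncurry C) {xs = pairs} p)))
    (λ p → ∈-filter⁺ (T? ∘ uncurry C) (∈-cartesianProduct⁺ (∈-allFin _) (∈-allFin _)) (from p))

-- Partitions into cycles and directed covers

weight : (A → A → ℕ) → List (List⁺ A) → ℕ
weight w cs = sum (map (uncurry w) (allArcs cs))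

-- The form of a cover in which cycles can be cut. The permutation says at once that the cycles are
-- simple, disjoint and spanning.
LCycles : Pred ℕ 0ℓ → (n : ℕ) → Pred (List (List⁺ (Fin n))) 0ℓ
LCycles L n cs = vertices cs ↭ allFin n × All (L ∘ length ∘ toList) cs

module CyclePartition {n} (cs : List (List⁺ (Fin n))) (perm : vertices cs ↭ allFin n) where

  unique-vertices : Unique (vertices cs)
  unique-vertices = unique-resp-↭ (↭-sym perm) (Unique.allFin⁺ n)

  -- A cycle has one arc leaving each of its vertices and one entering it, so distinctness of
  -- vertices carries over to sources and to targets.
  unique-sources : Unique (map proj₁ (allArcs cs))
  unique-sources = subst Unique (sym (allArcs-sources cs)) unique-vertices

  unique-targets : Unique (map proj₂ (allArcs cs))
  unique-targets = unique-resp-↭ (↭-sym (allArcs-targets cs)) unique-vertices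

  unique-allArcs : Unique (allArcs cs)
  unique-allArcs = Unique.map⁻ unique-sources

  same-target : ∀ {u v v′} → (u , v) ∈ allArcs cs → (u , v′) ∈ allArcs cs → v ≡ v′
  same-target p q = cong proj₂ (unique-map-injective proj₁ unique-sources p q refl)

  same-source : ∀ {u u′ v} → (u , v) ∈ allArcs cs → (u′ , v) ∈ allArcs cs → u ≡ u′
  same-source p q = cong proj₁ (unique-map-injective proj₂ unique-targets p q refl)

  ∈-vertices : ∀ u → u ∈ vertices cs
  ∈-vertices u = ∈-resp-↭ (↭-sym perm) (∈-allFin u)

  cycle-of : ∀ u → ∃ λ c → c ∈ cs × u ∈ toList c
  cycle-of u = find (∈-concatMap⁻ toList (∈-vertices u))

  out-arc : ∀ u → ∃ λ v → (u , v) ∈ allArcs cs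
  out-arc u with ∈-map⁻ proj₁ (subst (u ∈_) (sym (allArcs-sources cs)) (∈-vertices u))
  ... | (_ , v) , p , refl = v , p

  in-arc : ∀ v → ∃ λ u → (u , v) ∈ allArcs cs
  in-arc v with ∈-map⁻ proj₂ (∈-resp-↭ (↭-sym (allArcs-targets cs)) (∈-vertices v))
  ... | (u , _) , p , refl = u , p

  unique-cycle : ∀ {c} → c ∈ cs → Unique (toList c)
  unique-cycle = go unique-vertices
    where
    go : ∀ {cs c} → Unique (vertices cs) → c ∈ cs → Unique (toList c)
    go {c ∷ _}  u (here refl) = unique-++⁻ˡ (toList c) u
    go {c ∷ cs} u (there p)   = go (unique-++⁻ʳ (toList c) u) p

module DirectedCycles {L : Pred ℕ 0ℓ} {C : EdgeSet n} (cover : IsDirectedLCycleCover C L) where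

  open IsDirectedLCycleCover cover

  -- The cycle already uses the only arc leaving each of its vertices.
  cycle-closed : ∀ {c} → IsLongCycle C 0 c → Closed C (toList c)
  cycle-closed {x ∷ xs} (cyc , _) {u} {v} e u∈ with source⇒arc (x ∷ xs) u∈
  ... | b , ub with one-outgoing u
  ...   | _ , _ , only = subst (_∈ x ∷ xs) (trans (sym (only (cycle-edges C cyc ub))) (only e)) (target∈ (x ∷ xs) ub)

  decomposition : ∃ λ cs → All (IsLongCycle C 0) cs × vertices cs ↭ allFin n
  decomposition = cycle-decomposition C 0
    (λ z _ → let t , e , _ = one-incoming z in t , e , λ ()) cycle-closed

  lCycles : ∃ λ cs → LCycles L n cs × (∀ w → directedWeight C w ≡ weight w cs)
  lCycles with decomposition
  ... | cs , cycs , perm = cs , (perm , All.map (λ { {x ∷ xs} (cyc , _) → lengths x xs cyc }) cycs)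
    , λ w → directedWeight-arcs C w unique-allArcs to from
    where
    open CyclePartition cs perm
    from : ∀ {u v} → (u , v) ∈ allArcs cs → Edge C u v
    from p with find (∈-concatMap⁻ arcs p)
    ... | (x ∷ xs) , c∈ , a∈ = cycle-edges C (proj₁ (All.lookup cycs c∈)) a∈
    to : ∀ {u v} → Edge C u v → (u , v) ∈ allArcs cs
    to {u} e with out-arc u | one-outgoing u
    ... | b , ub | _ , _ , only = subst (λ v → (u , v) ∈ allArcs cs) (trans (sym (only (from ub))) (only e)) ub

module DirectedCover {L : Pred ℕ 0ℓ} (L≥2 : L ⊆ (2 ≤ⁿ_)) {cs : List (List⁺ (Fin n))}
                     (cycles : LCycles L n cs) where

  open import Data.List.Membership.DecPropositional (≡-dec (_≟_ {n}) (_≟_ {n})) using (_∈?_)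

  open CyclePartition cs (proj₁ cycles)

  edges : EdgeSet n
  edges u v = ⌊ (u , v) ∈? allArcs cs ⌋

  edge⇒arc : ∀ {u v} → Edge edges u v → (u , v) ∈ allArcs cs
  edge⇒arc {u} {v} = toWitness {a? = (u , v) ∈? allArcs cs}

  arc⇒edge : ∀ {u v} → (u , v) ∈ allArcs cs → Edge edges u v
  arc⇒edge {u} {v} = fromWitness {a? = (u , v) ∈? allArcs cs}

  -- Cycle lengths of at least 2 provide an arc that is not a loop; as `u` is the source of only one
  -- arc, this excludes loops.
  outgoing : ∀ u → ∃ λ b → u ≢ b × (u , b) ∈ allArcs cs
  outgoing u with cycle-of u
  ... | c@(_ ∷ _) , c∈ , u∈
    with successor c (unique-cycle c∈) (ℕ.s≤s⁻¹ (L≥2 (All.lookup (proj₂ cycles) c∈))) u∈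
  ... | b , u≢b , ub = b , u≢b , ∈-allArcs c∈ ub

  open IsDirectedLCycleCover

  one-out : ∀ u → ∃ λ v → Edge edges u v × (∀ {v′} → Edge edges u v′ → v ≡ v′)
  one-out u with out-arc u
  ... | v , p = v , arc⇒edge p , λ e → same-target p (edge⇒arc e)

  closed : ∀ {x xs} → IsCycle edges x xs → Closed edges (x ∷ xs)
  closed {x} {xs} cyc e u∈ with source⇒arc (x ∷ xs) u∈
  ... | b , ub = subst (_∈ x ∷ xs) (same-target (edge⇒arc (cycle-edges edges cyc ub)) (edge⇒arc e))
                       (target∈ (x ∷ xs) ub)

  isCover : IsDirectedLCycleCover edges L
  isCover .edges-proper {u} e refl with outgoing u
  ... | b , u≢b , ub = u≢b (same-target (edge⇒arc e) ub)
  isCover .one-outgoing = one-out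
  isCover .one-incoming v with in-arc v
  ... | u , p = u , arc⇒edge p , λ e → same-source p (edge⇒arc e)
  isCover .lengths x xs cyc with cycle-of x
  -- The listed cycle through `x` is also a cycle of `edges`. With one arc leaving each vertex both
  -- cycles are closed, so they have the same length.
  ... | (y ∷ ys) , c∈ , x∈ = subst L (sym (closed-cycles-same-length edges cyc cyc′ (closed cyc) (closed cyc′) x∈))
                                     (All.lookup (proj₂ cycles) c∈)
    where
    cyc′ : IsCycle edges y ys
    cyc′ = unique-cycle c∈ , steps-linked edges _ (λ p → arc⇒edge (∈-allArcs c∈ p))

  directedWeight-edges : ∀ w → directedWeight edges w ≡ weight w cs
  directedWeight-edges w = directedWeight-arcs edges w unique-allArcs edge⇒arc arc⇒edge

-- Undirected covers and oriented cycles

neighbourhood : EdgeSet n → Fin n → List (Fin n)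
neighbourhood {n} C u = filter (T? ∘ C u) (allFin n)

-- The enumeration `g` is kept apart from `f` so that the induction can shift it by `suc`.
∣tabulate∣ : ∀ {n} (f : A → Bool) (g : Fin n → A) →
             ∣ Vec.tabulate (f ∘ g) ∣ ≡ length (filter (T? ∘ f) (List.tabulate g))
∣tabulate∣ {n = zero}  f g = refl
∣tabulate∣ {n = suc n} f g with f (g zero)
... | true  = cong suc (∣tabulate∣ f (g ∘ suc))
... | false = ∣tabulate∣ f (g ∘ suc)

unique-neighbourhood : ∀ (C : EdgeSet n) u → Unique (neighbourhood C u)
unique-neighbourhood {n} C u = Unique.filter⁺ (T? ∘ C u) (Unique.allFin⁺ n)

∈-neighbourhood⁺ : ∀ {C : EdgeSet n} {u v} → Edge C u v → v ∈ neighbourhood C u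
∈-neighbourhood⁺ {C = C} {u} e = ∈-filter⁺ (T? ∘ C u) (∈-allFin _) e

∈-neighbourhood⁻ : ∀ {C : EdgeSet n} {u v} → v ∈ neighbourhood C u → Edge C u v
∈-neighbourhood⁻ {n} {C} {u} p = proj₂ (∈-filter⁻ (T? ∘ C u) {xs = allFin n} p)

pair-exhaustive : ∀ {xs : List A} {a b v} → length xs ≡ 2 → a ∈ xs → b ∈ xs → a ≢ b →
                  v ∈ xs → v ≡ a ⊎ v ≡ b
pair-exhaustive {xs = x ∷ y ∷ []} _ (here refl)         (here refl)         a≢b _ = contradiction refl a≢b
pair-exhaustive {xs = x ∷ y ∷ []} _ (there (here refl)) (there (here refl)) a≢b _ = contradiction refl a≢b
pair-exhaustive {xs = x ∷ y ∷ []} _ (here refl) (there (here refl)) _ (here refl)         = inj₁ refl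
pair-exhaustive {xs = x ∷ y ∷ []} _ (here refl) (there (here refl)) _ (there (here refl)) = inj₂ refl
pair-exhaustive {xs = x ∷ y ∷ []} _ (there (here refl)) (here refl) _ (here refl)         = inj₂ refl
pair-exhaustive {xs = x ∷ y ∷ []} _ (there (here refl)) (here refl) _ (there (here refl)) = inj₁ refl

pair-avoid : ∀ {xs : List (Fin n)} → Unique xs → length xs ≡ 2 → ∀ p → ∃ λ t → t ∈ xs × t ≢ p
pair-avoid {xs = x ∷ y ∷ []} ((x≢y ∷ []) ∷ _) _ p with x ≟ p
... | no  x≢p  = x , here refl , x≢p
... | yes refl = y , there (here refl) , x≢y ∘ sym

module TwoRegular {C : EdgeSet n} (symmetric : ∀ u v → C u v ≡ C v u)
                  (two-incident : ∀ u → ∣ Vec.tabulate (C u) ∣ ≡ 2) where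

  edge-sym : ∀ {u v} → Edge C u v → Edge C v u
  edge-sym {u} {v} = subst T (symmetric u v)

  degree : ∀ u → length (neighbourhood C u) ≡ 2
  degree u = trans (sym (∣tabulate∣ (C u) id)) (two-incident u)

  two-neighbours : ∀ {u a b v} → Edge C u a → Edge C u b → a ≢ b → Edge C u v → v ≡ a ⊎ v ≡ b
  two-neighbours ua ub a≢b uv =
    pair-exhaustive (degree _) (∈-neighbourhood⁺ {C = C} ua) (∈-neighbourhood⁺ {C = C} ub) a≢b (∈-neighbourhood⁺ {C = C} uv)

  other-neighbour : ∀ u p → ∃ λ t → Edge C u t × t ≢ p
  other-neighbour u p with pair-avoid (unique-neighbourhood C u) (degree u) p
  ... | t , t∈ , t≢p = t , ∈-neighbourhood⁻ {C = C} t∈ , t≢p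

  -- The two neighbours of `u` on the cycle differ and exhaust its degree, so no edge at `u` leaves
  -- the cycle.
  adjacent-arc : ∀ {c} → IsLongCycle C 2 c → ∀ {u v} → Edge C u v → u ∈ toList c →
                 (u , v) ∈ arcs c ⊎ (v , u) ∈ arcs c
  adjacent-arc {x ∷ xs} (cyc , long) e u∈ with neighbours (x ∷ xs) (proj₁ cyc) long u∈
  ... | a , b , a≢b , au , ub
    with two-neighbours (edge-sym (cycle-edges C cyc au)) (cycle-edges C cyc ub) a≢b e
  ...   | inj₁ refl = inj₂ au
  ...   | inj₂ refl = inj₁ ub

  cycle-closed : ∀ {c} → IsLongCycle C 2 c → Closed C (toList c)
  cycle-closed {c} cyc {u} {v} e u∈ with adjacent-arc cyc e u∈
  ... | inj₁ uv = target∈ c uv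
  ... | inj₂ vu = subst (v ∈_) (arcs-sources c) (∈-map⁺ proj₁ vu)

module UndirectedPartition {n} (cs : List (List⁺ (Fin n))) (perm : vertices cs ↭ allFin n)
                           (long : All (λ c → 3 ≤ⁿ length (toList c)) cs) where

  open CyclePartition cs perm

  all-neighbours : ∀ u → ∃₂ λ a b → a ≢ b × (a , u) ∈ allArcs cs × (u , b) ∈ allArcs cs
  all-neighbours u with cycle-of u
  ... | c@(_ ∷ _) , c∈ , u∈
    with neighbours c (unique-cycle c∈) (ℕ.s≤s⁻¹ (All.lookup long c∈)) u∈
  ... | a , b , a≢b , au , ub = a , b , a≢b , ∈-allArcs c∈ au , ∈-allArcs c∈ ub

  -- Otherwise `v` would be both predecessor and successor of `u`, and these differ on cycles of
  -- length at least 3.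
  antisymmetric : ∀ {u v} → (u , v) ∈ allArcs cs → (v , u) ∉ allArcs cs
  antisymmetric {u} uv vu with all-neighbours u
  ... | a , b , a≢b , au , ub = a≢b (trans (same-source au vu) (same-target uv ub))

  orient : Fin n × Fin n → Fin n × Fin n
  orient (u , v) = if toℕ u <ᵇ toℕ v then (u , v) else (v , u)

  -- Two different arcs on one undirected edge would be opposite to each other. Hence summing over
  -- arcs counts each undirected edge once.
  orient-≡ : ∀ {a b} → a ∈ allArcs cs → b ∈ allArcs cs → orient a ≡ orient b → a ≡ b
  orient-≡ {u , v} {u′ , v′} a∈ b∈ eq with toℕ u <ᵇ toℕ v | toℕ u′ <ᵇ toℕ v′
  orient-≡ a∈ b∈ refl | true  | true  = refl
  orient-≡ a∈ b∈ refl | true  | false = contradiction b∈ (antisymmetric a∈)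
  orient-≡ a∈ b∈ refl | false | true  = contradiction b∈ (antisymmetric a∈)
  orient-≡ a∈ b∈ refl | false | false = refl

  undirectedWeight-arcs : ∀ {C : EdgeSet n} {w : Weights n} → (∀ u v → w u v ≡ w v u) →
    (∀ u v → C u v ≡ C v u) →
    (∀ {u v} → Edge C u v → (u , v) ∈ allArcs cs ⊎ (v , u) ∈ allArcs cs) →
    (∀ {u v} → (u , v) ∈ allArcs cs → Edge C u v) →
    undirectedWeight C w ≡ weight w cs
  undirectedWeight-arcs {C} {w} w-sym C-sym to from = begin
    undirectedWeight C w
      -- The implicit edge set is the part of `C` that points from smaller to larger vertices; its
      -- directed weight is `undirectedWeight C w` by definition.
      ≡⟨ directedWeight-arcs _ w (unique-map⁺ orient unique-allArcs orient-≡) to′ from′ ⟩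
    sum (map (uncurry w) (map orient (allArcs cs)))
      ≡⟨ cong sum (map-∘ (allArcs cs)) ⟨
    sum (map (uncurry w ∘ orient) (allArcs cs))
      ≡⟨ cong sum (map-cong w-orient (allArcs cs)) ⟩
    weight w cs
      ∎
    where
    open ≡-Reasoning
    w-orient : ∀ a → uncurry w (orient a) ≡ uncurry w a
    w-orient (u , v) with toℕ u <ᵇ toℕ v
    ... | true  = refl
    ... | false = w-sym v u
    orient-< : ∀ {u v} → toℕ u <ⁿ toℕ v → orient (u , v) ≡ (u , v)
    orient-< {u} {v} u<v with toℕ u <ᵇ toℕ v | ℕ.<⇒<ᵇ u<v
    ... | true | _ = refl
    orient-> : ∀ {u v} → toℕ u <ⁿ toℕ v → orient (v , u) ≡ (u , v)
    orient-> {u} {v} u<v with toℕ v <ᵇ toℕ u in eq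
    ... | true  = contradiction (ℕ.<ᵇ⇒< (toℕ v) (toℕ u) (subst T (sym eq) tt)) (ℕ.<⇒≯ u<v)
    ... | false = refl
    to′ : ∀ {u v} → T ((toℕ u <ᵇ toℕ v) ∧ C u v) → (u , v) ∈ map orient (allArcs cs)
    to′ {u} {v} t with Equivalence.to T-∧ t
    ... | lt , e with ℕ.<ᵇ⇒< (toℕ u) (toℕ v) lt | to e
    ...   | u<v | inj₁ p = subst (_∈ map orient (allArcs cs)) (orient-< u<v) (∈-map⁺ orient p)
    ...   | u<v | inj₂ p = subst (_∈ map orient (allArcs cs)) (orient-> u<v) (∈-map⁺ orient p)
    oriented : ∀ u v → (u , v) ∈ allArcs cs →
               uncurry (λ u v → T ((toℕ u <ᵇ toℕ v) ∧ C u v)) (orient (u , v))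
    oriented u v p with toℕ u <ᵇ toℕ v in eq
    ... | true  = Equivalence.from T-∧ (subst T (sym eq) tt , from p)
    ... | false with ℕ.<-cmp (toℕ u) (toℕ v)
    ...   | tri< u<v _ _ = ⊥-elim (subst T eq (ℕ.<⇒<ᵇ u<v))
    ...   | tri≈ _ u≡v _ = ⊥-elim (loop (toℕ-injective u≡v) p)
      where
      loop : u ≡ v → (u , v) ∉ allArcs cs
      loop refl q = antisymmetric q q
    ...   | tri> _ _ v<u = Equivalence.from T-∧ (ℕ.<⇒<ᵇ v<u , subst T (C-sym u v) (from p))
    from′ : ∀ {u v} → (u , v) ∈ map orient (allArcs cs) → T ((toℕ u <ᵇ toℕ v) ∧ C u v)
    from′ q with ∈-map⁻ orient q
    ... | (u , v) , p , eq = subst (uncurry λ u v → T ((toℕ u <ᵇ toℕ v) ∧ C u v)) (sym eq) (oriented u v p)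

module UndirectedCycles {L : Pred ℕ 0ℓ} {C : EdgeSet n} (cover : IsUndirectedLCycleCover C L) where

  open IsUndirectedLCycleCover cover
  open TwoRegular symmetric two-incident

  -- Of the two neighbours of `z`, one is not the vertex just left, so the path need never turn
  -- back.
  predecessor : ∀ z ps → ∃ λ t → Edge C t z × t ∉ take 2 (z ∷ ps)
  -- A path of one vertex has no previous vertex to avoid; `z` itself takes that place.
  predecessor z [] with other-neighbour z z
  ... | t , e , t≢z = t , edge-sym e , λ { (here refl) → t≢z refl }
  predecessor z (p ∷ ps) with other-neighbour z p
  ... | t , e , t≢p = t , edge-sym e
    , λ { (here refl) → edges-proper e refl ; (there (here refl)) → t≢p refl }

  lCycles : ∃ λ cs → LCycles L n cs ×
            (∀ {w} → (∀ u v → w u v ≡ w v u) → undirectedWeight C w ≡ weight w cs)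
  lCycles with cycle-decomposition C 2 predecessor cycle-closed
  ... | cs , cycs , perm =
    cs , (perm , All.map (λ { {x ∷ xs} (cyc , long) → lengths x xs (s≤s long) cyc }) cycs)
    , λ w-sym → undirectedWeight-arcs w-sym symmetric to from
    where
    open CyclePartition cs perm
    lengths≥3 : All (λ c → 3 ≤ⁿ length (toList c)) cs
    lengths≥3 = All.map (λ { {_ ∷ _} (_ , long) → s≤s long }) cycs
    open UndirectedPartition cs perm lengths≥3
    from : ∀ {u v} → (u , v) ∈ allArcs cs → Edge C u v
    from p with find (∈-concatMap⁻ arcs p)
    ... | (x ∷ xs) , c∈ , a∈ = cycle-edges C (proj₁ (All.lookup cycs c∈)) a∈
    to : ∀ {u v} → Edge C u v → (u , v) ∈ allArcs cs ⊎ (v , u) ∈ allArcs cs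
    to {u} e with cycle-of u
    ... | c , c∈ , u∈ with adjacent-arc (All.lookup cycs c∈) e u∈
    ...   | inj₁ p = inj₁ (∈-allArcs c∈ p)
    ...   | inj₂ p = inj₂ (∈-allArcs c∈ p)

module UndirectedCover {L : Pred ℕ 0ℓ} (L≥3 : L ⊆ (3 ≤ⁿ_)) {cs : List (List⁺ (Fin n))}
                       (cycles : LCycles L n cs) where

  open import Data.List.Membership.DecPropositional (≡-dec (_≟_ {n}) (_≟_ {n})) using (_∈?_)
  open CyclePartition cs (proj₁ cycles)
  open UndirectedPartition cs (proj₁ cycles) (All.map L≥3 (proj₂ cycles))

  edges : EdgeSet n
  edges u v = ⌊ (u , v) ∈? allArcs cs ⌋ ∨ ⌊ (v , u) ∈? allArcs cs ⌋

  edge⇒arc : ∀ {u v} → Edge edges u v → (u , v) ∈ allArcs cs ⊎ (v , u) ∈ allArcs cs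
  edge⇒arc {u} {v} e with Equivalence.to T-∨ e
  ... | inj₁ p = inj₁ (toWitness {a? = (u , v) ∈? allArcs cs} p)
  ... | inj₂ p = inj₂ (toWitness {a? = (v , u) ∈? allArcs cs} p)

  arc⇒edge : ∀ {u v} → (u , v) ∈ allArcs cs → Edge edges u v
  arc⇒edge {u} {v} p = Equivalence.from T-∨ (inj₁ (fromWitness {a? = (u , v) ∈? allArcs cs} p))

  arc⇒edgeʳ : ∀ {u v} → (u , v) ∈ allArcs cs → Edge edges v u
  arc⇒edgeʳ {u} {v} p = Equivalence.from T-∨ (inj₂ (fromWitness {a? = (u , v) ∈? allArcs cs} p))

  edges-symmetric : ∀ u v → edges u v ≡ edges v u
  edges-symmetric u v = ∨-comm ⌊ (u , v) ∈? allArcs cs ⌋ ⌊ (v , u) ∈? allArcs cs ⌋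

  edges-two-incident : ∀ u → ∣ Vec.tabulate (edges u) ∣ ≡ 2
  edges-two-incident u with all-neighbours u
  ... | a , b , a≢b , au , ub = trans (∣tabulate∣ (edges u) id) (↭-length perm)
    where
    to : ∀ {v} → v ∈ neighbourhood edges u → v ∈ a ∷ b ∷ []
    to v∈ with edge⇒arc (∈-neighbourhood⁻ {C = edges} v∈)
    ... | inj₁ uv = there (here (same-target uv ub))
    ... | inj₂ vu = here (same-source vu au)
    from : ∀ {v} → v ∈ a ∷ b ∷ [] → v ∈ neighbourhood edges u
    from (here refl)         = ∈-neighbourhood⁺ {C = edges} (arc⇒edgeʳ au)
    from (there (here refl)) = ∈-neighbourhood⁺ {C = edges} (arc⇒edge ub)
    perm : neighbourhood edges u ↭ a ∷ b ∷ []
    perm = unique∧⊆∧⊇⇒↭ (unique-neighbourhood edges u) ((a≢b ∷ []) ∷ [] ∷ []) to from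

  open TwoRegular edges-symmetric edges-two-incident using (cycle-closed)
  open IsUndirectedLCycleCover

  isCover : IsUndirectedLCycleCover edges L
  isCover .edges-proper e refl with edge⇒arc e
  ... | inj₁ p = antisymmetric p p
  ... | inj₂ p = antisymmetric p p
  isCover .symmetric    = edges-symmetric
  isCover .two-incident = edges-two-incident
  isCover .lengths x xs long cyc with cycle-of x
  ... | (y ∷ ys) , c∈ , x∈ = subst L (sym same) (All.lookup (proj₂ cycles) c∈)
    where
    cyc′ : IsCycle edges y ys
    cyc′ = unique-cycle c∈ , steps-linked edges _ (λ p → arc⇒edge (∈-allArcs c∈ p))
    long′ : 2 ≤ⁿ length ys
    long′ = ℕ.s≤s⁻¹ (L≥3 (All.lookup (proj₂ cycles) c∈))
    -- Degree 2 makes every cycle with at least three vertices closed, so the given cycle and the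
    -- listed one agree in length.
    same : length (x ∷ xs) ≡ length (y ∷ ys)
    same = closed-cycles-same-length edges cyc cyc′
      (cycle-closed (cyc , ℕ.s≤s⁻¹ long)) (cycle-closed (cyc′ , long′)) x∈

  undirectedWeight-edges : ∀ {w} → (∀ u v → w u v ≡ w v u) → undirectedWeight edges w ≡ weight w cs
  undirectedWeight-edges w-sym = undirectedWeight-arcs w-sym edges-symmetric edge⇒arc arc⇒edge

-- Finite sums and periodic sequences

applyUpTo-cong : {f g : ℕ → A} → f ≗ g → applyUpTo f ≗ applyUpTo g
applyUpTo-cong f≗g zero    = refl
applyUpTo-cong f≗g (suc m) = cong₂ _∷_ (f≗g 0) (applyUpTo-cong (f≗g ∘ suc) m)

applyUpTo-+ : ∀ (f : ℕ → A) m n → applyUpTo f (m + n) ≡ applyUpTo f m ++ applyUpTo (λ i → f (m + i)) n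
applyUpTo-+ f zero    n = refl
applyUpTo-+ f (suc m) n = cong (f 0 ∷_) (applyUpTo-+ (f ∘ suc) m n)

sum-∷ʳ : ∀ ms m → sum (ms ∷ʳ m) ≡ sum ms + m
sum-∷ʳ ms m = trans (sum-++ ms (m ∷ [])) (cong (sum ms ℕ.+_) (ℕ.+-identityʳ m))

sum-applyUpTo-0 : ∀ m → sum (applyUpTo (const 0) m) ≡ 0
sum-applyUpTo-0 zero    = refl
sum-applyUpTo-0 (suc m) = sum-applyUpTo-0 m

sum-applyUpTo-+ : ∀ f g m → sum (applyUpTo (λ i → f i + g i) m) ≡ sum (applyUpTo f m) + sum (applyUpTo g m)
sum-applyUpTo-+ f g zero    = refl
sum-applyUpTo-+ f g (suc m) =
  trans (cong (f 0 + g 0 ℕ.+_) (sum-applyUpTo-+ (f ∘ suc) (g ∘ suc) m))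
        (+.interchange (f 0) (g 0) _ _)

-- The least value is at most the average.
∃-below-average : ∀ f m → ∃ λ j → suc m *ⁿ f j ≤ⁿ sum (applyUpTo f (suc m))
∃-below-average f zero = 0 , ℕ.≤-refl
∃-below-average f (suc m) with ∃-below-average (f ∘ suc) m
... | j , le with ℕ.≤-total (f 0) (f (suc j))
...   | inj₁ f0≤ = 0 , ℕ.+-monoʳ-≤ (f 0) (ℕ.≤-trans (ℕ.*-monoʳ-≤ (suc m) f0≤) le)
...   | inj₂ ≤f0 = suc j , ℕ.+-mono-≤ ≤f0 le

Periodic : ℕ → (ℕ → A) → Set
Periodic p v = ∀ i → v (p + i) ≡ v i

periodic-suc : ∀ {p} {v : ℕ → A} → Periodic p v → Periodic p (v ∘ suc)
periodic-suc {p = p} {v} per i = trans (cong v (sym (ℕ.+-suc p i))) (per (suc i))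

periodic-+ : ∀ {p} {v : ℕ → A} k → Periodic p v → Periodic p (λ i → v (k + i))
periodic-+ zero    per = per
periodic-+ (suc k) per = periodic-+ k (periodic-suc per)

-- A shift by one removes `v 0` in front and appends `v p`, which equals `v 0`.
periodic-↭ : ∀ {p} {v : ℕ → A} → Periodic p v → ∀ k → applyUpTo (λ i → v (k + i)) p ↭ applyUpTo v p
periodic-↭         per zero    = ↭-refl
periodic-↭ {p = p} {v} per (suc k) = ↭-trans (periodic-↭ (periodic-suc per) k)
  (↭.drop-∷ (↭-trans (↭-reflexive wrap) (↭-sym (∷↭∷ʳ (v 0) (applyUpTo v p)))))
  where
  wrap : applyUpTo v (suc p) ≡ applyUpTo v p ∷ʳ v 0
  wrap = trans (sym (applyUpTo-∷ʳ v p))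
               (cong (applyUpTo v p ∷ʳ_) (trans (cong v (sym (ℕ.+-identityʳ p))) (per 0)))

-- Cutting a cycle into pieces of prescribed lengths

module _ (c : List⁺ A) where

  -- Unrolls the cycle into an infinite sequence: the rest `y ∷ ys` of the current round, then `c`
  -- over and over. Rotations become index shifts, without modular arithmetic.
  walk : A → List A → ℕ → A
  walk y ys       zero    = y
  walk y []       (suc i) = walk (List⁺.head c) (List⁺.tail c) i
  walk y (z ∷ zs) (suc i) = walk z zs i

  around : ℕ → A
  around = walk (List⁺.head c) (List⁺.tail c)

  walk-wraps : ∀ y ys i → walk y ys (suc (length ys) + i) ≡ around i
  walk-wraps y []       i = refl
  walk-wraps y (z ∷ zs) i = walk-wraps z zs i

  walk-prefix : ∀ y ys → applyUpTo (walk y ys) (suc (length ys)) ≡ y ∷ ys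
  walk-prefix y []       = refl
  walk-prefix y (z ∷ zs) = cong (y ∷_) (walk-prefix z zs)

  around-periodic : Periodic (length (toList c)) around
  around-periodic = walk-wraps (List⁺.head c) (List⁺.tail c)

  around-prefix : applyUpTo around (length (toList c)) ≡ toList c
  around-prefix = walk-prefix _ _

-- Consecutive blocks of the sequence, each read as a cycle of its own. A block has at least its
-- first vertex, so the lengths come out as `ks` only when all of them are positive.
chop : List ℕ → (ℕ → A) → List (List⁺ A)
chop []       v = []
chop (k ∷ ks) v = (v 0 ∷ applyUpTo (v ∘ suc) (pred k)) ∷ chop ks (λ i → v (k + i))

chop-vertices : ∀ {ks} → All (1 ≤ⁿ_) ks → (v : ℕ → A) → vertices (chop ks v) ≡ applyUpTo v (sum ks)
chop-vertices []                           v = refl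
chop-vertices {ks = suc k ∷ ks} (_ ∷ ks≥1) v = cong (v 0 ∷_)
  (trans (cong (applyUpTo (v ∘ suc) k ++_) (chop-vertices ks≥1 _)) (sym (applyUpTo-+ (v ∘ suc) k (sum ks))))

chop-lengths : ∀ {ks} → All (1 ≤ⁿ_) ks → (v : ℕ → A) → map (length ∘ toList) (chop ks v) ≡ ks
chop-lengths []                           v = refl
chop-lengths {ks = suc k ∷ ks} (_ ∷ ks≥1) v =
  cong₂ _∷_ (cong suc (length-applyUpTo (v ∘ suc) k)) (chop-lengths ks≥1 _)

-- a i is the weight of the arc leaving position i; a piece loses the arc leaving
-- its last vertex.

loss : List ℕ → (ℕ → ℕ) → ℕ
loss []       a = 0
loss (k ∷ ks) a = a (pred k) + loss ks (λ i → a (k + i))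

loss-cong : ∀ ks {a b} → a ≗ b → loss ks a ≡ loss ks b
loss-cong []       a≗b = refl
loss-cong (k ∷ ks) a≗b = cong₂ _+_ (a≗b (pred k)) (loss-cong ks (λ i → a≗b (k + i)))

-- Each of the length ks lost arcs runs through the whole cycle as the starting
-- point j varies over a period.

total-loss : ∀ ks {p} a → Periodic p a →
  sum (applyUpTo (λ j → loss ks (λ i → a (j + i))) p) ≡ length ks *ⁿ sum (applyUpTo a p)
total-loss []       {p} a per = sum-applyUpTo-0 p
total-loss (k ∷ ks) {p} a per = begin
  sum (applyUpTo (λ j → a (j + pred k) + loss ks (λ i → a (j + (k + i)))) p)
    ≡⟨ sum-applyUpTo-+ _ _ p ⟩
  sum (applyUpTo (λ j → a (j + pred k)) p) + sum (applyUpTo (λ j → loss ks (λ i → a (j + (k + i)))) p)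
    ≡⟨ cong₂ _+_
         (cong sum (applyUpTo-cong (λ j → cong a (ℕ.+-comm j (pred k))) p))
         (cong sum (applyUpTo-cong (λ j → loss-cong ks (λ i → cong a (+.x∙yz≈y∙xz j k i))) p)) ⟩
  sum (applyUpTo (λ j → a (pred k + j)) p) + sum (applyUpTo (λ j → loss ks (λ i → a (k + (j + i)))) p)
    ≡⟨ cong₂ _+_ (sum-↭ (periodic-↭ per (pred k))) (total-loss ks (λ i → a (k + i)) (periodic-+ k per)) ⟩
  sum (applyUpTo a p) + length ks *ⁿ sum (applyUpTo (λ i → a (k + i)) p)
    ≡⟨ cong (λ s → sum (applyUpTo a p) + length ks *ⁿ s) (sum-↭ (periodic-↭ per k)) ⟩
  sum (applyUpTo a p) + length ks *ⁿ sum (applyUpTo a p)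
    ∎
  where
  open ≡-Reasoning

steps-applyUpTo : ∀ (v : ℕ → A) m → steps (applyUpTo v (suc m)) ≡ applyUpTo (λ i → v i , v (suc i)) m
steps-applyUpTo v zero    = refl
steps-applyUpTo v (suc m) = cong (_ ∷_) (steps-applyUpTo (v ∘ suc) m)

sum-steps-∷ʳ : ∀ (f : A × A → ℕ) xs y → sum (map f (steps xs)) ≤ⁿ sum (map f (steps (xs ∷ʳ y)))
sum-steps-∷ʳ f []            y = z≤n
sum-steps-∷ʳ f (x ∷ [])      y = z≤n
sum-steps-∷ʳ f (x ∷ x′ ∷ xs) y = ℕ.+-monoʳ-≤ (f (x , x′)) (sum-steps-∷ʳ f (x′ ∷ xs) y)

cycleWeight : (A → A → ℕ) → List⁺ A → ℕ
cycleWeight w c = sum (map (uncurry w) (arcs c))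

weight-∷ : ∀ (w : A → A → ℕ) c cs → weight w (c ∷ cs) ≡ cycleWeight w c + weight w cs
weight-∷ w c cs = trans (cong sum (map-++ (uncurry w) (arcs c) _)) (sum-++ (map (uncurry w) (arcs c)) _)

weight-++ : ∀ (w : A → A → ℕ) cs ds → weight w (cs ++ ds) ≡ weight w cs + weight w ds
weight-++ w []       ds = refl
weight-++ w (c ∷ cs) ds = begin
  weight w (c ∷ cs ++ ds)                         ≡⟨ weight-∷ w c (cs ++ ds) ⟩
  cycleWeight w c + weight w (cs ++ ds)           ≡⟨ cong (cycleWeight w c ℕ.+_) (weight-++ w cs ds) ⟩
  cycleWeight w c + (weight w cs + weight w ds)   ≡⟨ ℕ.+-assoc (cycleWeight w c) _ _ ⟨
  (cycleWeight w c + weight w cs) + weight w ds   ≡⟨ cong (ℕ._+ weight w ds) (weight-∷ w c cs) ⟨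
  weight w (c ∷ cs) + weight w ds                 ∎
  where open ≡-Reasoning

-- A block keeps its inner arcs and gains a closing arc of nonnegative weight; the arc to the next
-- block is what `loss` counts. With `a` as a separate argument, the index arithmetic of shifts is
-- confined to the equation linking it to `w`.
chop-weight : ∀ {ks} → All (1 ≤ⁿ_) ks → (w : A → A → ℕ) (v : ℕ → A) (a : ℕ → ℕ) →
  (∀ i → w (v i) (v (suc i)) ≡ a i) →
  sum (applyUpTo a (sum ks)) ≤ⁿ weight w (chop ks v) + loss ks a
chop-weight []                           w v a eq = z≤n
chop-weight {ks = suc k ∷ ks} (_ ∷ ks≥1) w v a eq = begin
  sum (applyUpTo a (suc k + sum ks))
    ≡⟨ cong sum (applyUpTo-+ a (suc k) (sum ks)) ⟩
  sum (applyUpTo a (suc k) ++ applyUpTo b (sum ks))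
    ≡⟨ sum-++ (applyUpTo a (suc k)) _ ⟩
  sum (applyUpTo a (suc k)) + sum (applyUpTo b (sum ks))
    ≡⟨ cong (ℕ._+ sum (applyUpTo b (sum ks)))
         (trans (cong sum (sym (applyUpTo-∷ʳ a k))) (sum-∷ʳ (applyUpTo a k) (a k))) ⟩
  sum (applyUpTo a k) + a k + sum (applyUpTo b (sum ks))
    ≤⟨ ℕ.+-mono-≤ (ℕ.+-monoˡ-≤ (a k) piece) rest ⟩
  cycleWeight w c + a k + (weight w cs + loss ks b)
    ≡⟨ +.interchange (cycleWeight w c) (a k) _ _ ⟩
  cycleWeight w c + weight w cs + (a k + loss ks b)
    ≡⟨ cong (ℕ._+ (a k + loss ks b)) (weight-∷ w c cs) ⟨
  weight w (c ∷ cs) + loss (suc k ∷ ks) a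
    ∎
  where
  open ℕ.≤-Reasoning
  b = λ i → a (suc k + i)
  c = v 0 ∷ applyUpTo (v ∘ suc) k
  cs = chop ks (λ i → v (suc k + i))
  piece : sum (applyUpTo a k) ≤ⁿ cycleWeight w c
  piece = begin
    sum (applyUpTo a k)
      ≡⟨ cong sum (applyUpTo-cong eq k) ⟨
    sum (applyUpTo (λ i → w (v i) (v (suc i))) k)
      ≡⟨ cong sum (map-applyUpTo (λ i → v i , v (suc i)) (uncurry w) k) ⟨
    sum (map (uncurry w) (applyUpTo (λ i → v i , v (suc i)) k))
      ≡⟨ cong (sum ∘ map (uncurry w)) (steps-applyUpTo v k) ⟨
    sum (map (uncurry w) (steps (applyUpTo v (suc k))))
      ≤⟨ sum-steps-∷ʳ (uncurry w) (applyUpTo v (suc k)) (v 0) ⟩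
    cycleWeight w c
      ∎
  rest : sum (applyUpTo b (sum ks)) ≤ⁿ weight w cs + loss ks b
  rest = chop-weight ks≥1 w _ b λ i →
    trans (cong (λ j → w (v (suc k + i)) (v j)) (ℕ.+-suc (suc k) i)) (eq (suc k + i))

cycleWeight-around : ∀ (w : A → A → ℕ) c →
  cycleWeight w c ≡ sum (applyUpTo (λ i → w (around c i) (around c (suc i))) (length (toList c)))
cycleWeight-around w c@(x ∷ xs) = begin
  sum (map (uncurry w) (steps (x ∷ xs ∷ʳ x)))
    ≡⟨ cong (sum ∘ map (uncurry w) ∘ steps) closed ⟨
  sum (map (uncurry w) (steps (applyUpTo v (suc p))))
    ≡⟨ cong (sum ∘ map (uncurry w)) (steps-applyUpTo v p) ⟩
  sum (map (uncurry w) (applyUpTo (λ i → v i , v (suc i)) p))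
    ≡⟨ cong sum (map-applyUpTo (λ i → v i , v (suc i)) (uncurry w) p) ⟩
  sum (applyUpTo (λ i → w (v i) (v (suc i))) p)
    ∎
  where
  open ≡-Reasoning
  v = around c
  p = length (x ∷ xs)
  closed : applyUpTo v (suc p) ≡ x ∷ xs ∷ʳ x
  closed = trans (sym (applyUpTo-∷ʳ v p))
    (cong₂ _∷ʳ_ (around-prefix c) (trans (cong v (sym (ℕ.+-identityʳ p))) (around-periodic c 0)))

-- Over the `p` starting points the losses add up to `length ks` times the weight of the cycle, so
-- the best start loses at most the average. Multiplying by `p` keeps the inequality within the
-- naturals.
cut-cycle : ∀ (w : A → A → ℕ) c {ks} → All (1 ≤ⁿ_) ks → sum ks ≡ length (toList c) →
  ∃ λ ds → vertices ds ↭ toList c × map (length ∘ toList) ds ≡ ks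
    × length (toList c) *ⁿ cycleWeight w c
        ≤ⁿ length (toList c) *ⁿ weight w ds + length ks *ⁿ cycleWeight w c
cut-cycle {A} w c@(x ∷ xs) {ks} ks≥1 sum≡ = ds , perm , chop-lengths ks≥1 _ , (begin
  p *ⁿ cycleWeight w c
    ≡⟨ cong (p *ⁿ_) W≡ ⟩
  p *ⁿ sum (applyUpTo a p)
    ≡⟨ cong (p *ⁿ_) (sum-↭ (periodic-↭ a-periodic j)) ⟨
  p *ⁿ sum (applyUpTo (λ i → a (j + i)) p)
    ≤⟨ ℕ.*-monoʳ-≤ p pieces ⟩
  p *ⁿ (weight w ds + lost j)
    ≡⟨ ℕ.*-distribˡ-+ p (weight w ds) (lost j) ⟩
  p *ⁿ weight w ds + p *ⁿ lost j
    ≤⟨ ℕ.+-monoʳ-≤ (p *ⁿ weight w ds) (proj₂ best) ⟩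
  p *ⁿ weight w ds + sum (applyUpTo lost p)
    ≡⟨ cong (p *ⁿ weight w ds ℕ.+_) (total-loss ks a a-periodic) ⟩
  p *ⁿ weight w ds + length ks *ⁿ sum (applyUpTo a p)
    ≡⟨ cong (λ s → p *ⁿ weight w ds + length ks *ⁿ s) W≡ ⟨
  p *ⁿ weight w ds + length ks *ⁿ cycleWeight w c
    ∎)
  where
  open ℕ.≤-Reasoning
  p = length (x ∷ xs)
  v = around c
  a : ℕ → ℕ
  a i = w (v i) (v (suc i))
  a-periodic : Periodic p a
  a-periodic i = cong₂ w (around-periodic c i) (periodic-suc (around-periodic c) i)
  W≡ : cycleWeight w c ≡ sum (applyUpTo a p)
  W≡ = cycleWeight-around w c
  lost : ℕ → ℕ
  lost j = loss ks (λ i → a (j + i))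
  best : ∃ λ j → p *ⁿ lost j ≤ⁿ sum (applyUpTo lost p)
  best = ∃-below-average lost (length xs)
  j = proj₁ best
  ds : List (List⁺ A)
  ds = chop ks (λ i → v (j + i))
  perm : vertices ds ↭ x ∷ xs
  perm = ↭-trans (↭-reflexive (trans (chop-vertices ks≥1 _) (cong (applyUpTo (λ i → v (j + i))) sum≡)))
        (↭-trans (periodic-↭ (around-periodic c) j) (↭-reflexive (around-prefix c)))
  pieces : sum (applyUpTo (λ i → a (j + i)) p) ≤ⁿ weight w ds + lost j
  pieces = subst (λ m → sum (applyUpTo (λ i → a (j + i)) m) ≤ⁿ weight w ds + lost j) sum≡
    (chop-weight ks≥1 w _ _ λ i → cong (λ k → w (v (j + i)) (v k)) (ℕ.+-suc j i))

-- Existence of maxima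

-- Descent from the bound: excluded middle decides whether `suc b` is attained, and if not, the
-- bound drops by one.
max-exists : ExcludedMiddle 0ℓ → {P : Pred A 0ℓ} (f : A → ℕ) → Satisfiable P →
             ∀ b → (∀ x → P x → f x ≤ⁿ b) → ∃ (IsMaximum P f)
max-exists em f (x , px) zero bound =
  f x , (x , px , refl) , λ y py → ℕ.≤-trans (bound y py) z≤n
max-exists em {P} f sat (suc b) bound with em {∃ λ x → P x × f x ≡ suc b}
... | yes (x , px , eq) = suc b , (x , px , eq) , bound
... | no  none          = max-exists em f sat b λ x px →
        ℕ.s≤s⁻¹ (ℕ.≤∧≢⇒< (bound x px) λ eq → none (x , px , eq))

Σ-mono-≤ : ∀ n {f g : Fin n → ℕ} → (∀ u → f u ≤ⁿ g u) → ∑[ u < n ] f u ≤ⁿ ∑[ u < n ] g u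
Σ-mono-≤ zero    f≤g = z≤n
Σ-mono-≤ (suc n) f≤g = ℕ.+-mono-≤ (f≤g zero) (Σ-mono-≤ n (f≤g ∘ suc))

directedWeight-≤ : ∀ (C : EdgeSet n) w → directedWeight C w ≤ⁿ directedWeight (λ _ _ → true) w
directedWeight-≤ {n} C w = Σ-mono-≤ n λ u → Σ-mono-≤ n λ v → bound u v
  where
  bound : ∀ u v → (if C u v then w u v else 0) ≤ⁿ w u v
  bound u v with C u v
  ... | true  = ℕ.≤-refl
  ... | false = z≤n

-- Truncating the set of lengths

sum-replicate : ∀ j k → sum (replicate j k) ≡ j *ⁿ k
sum-replicate zero    k = refl
sum-replicate (suc j) k = cong (k ℕ.+_) (sum-replicate j k)

congruent⇒+-multiple : ∀ {x y} d .{{_ : NonZero d}} → x ≤ⁿ y → x % d ≡ y % d → ∃ λ j → x + j *ⁿ d ≡ y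
congruent⇒+-multiple {x} {y} d x≤y eq = y ÷ d ∸ x ÷ d , (begin
  x + (y ÷ d ∸ x ÷ d) *ⁿ d                       ≡⟨ cong (ℕ._+ (y ÷ d ∸ x ÷ d) *ⁿ d) (m≡m%n+[m/n]*n x d) ⟩
  x % d + x ÷ d *ⁿ d + (y ÷ d ∸ x ÷ d) *ⁿ d      ≡⟨ ℕ.+-assoc (x % d) _ _ ⟩
  x % d + (x ÷ d *ⁿ d + (y ÷ d ∸ x ÷ d) *ⁿ d)    ≡⟨ cong (x % d ℕ.+_) (ℕ.*-distribʳ-+ d (x ÷ d) _) ⟨
  x % d + (x ÷ d + (y ÷ d ∸ x ÷ d)) *ⁿ d         ≡⟨ cong₂ (λ r k → r + k *ⁿ d) eq (ℕ.m+[n∸m]≡n (/-monoˡ-≤ d x≤y)) ⟩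
  y % d + y ÷ d *ⁿ d                             ≡⟨ m≡m%n+[m/n]*n y d ⟨
  y                                              ∎)
  where open ≡-Reasoning

module Truncation (em : ExcludedMiddle 0ℓ) (L : Pred ℕ 0ℓ) (L≥2 : L ⊆ (2 ≤ⁿ_)) where

  -- For each value of `r` below `m`, excluded middle yields an element of `L` attaining it if there
  -- is one; `N` bounds these finitely many choices.
  representatives : ∀ (r : ℕ → ℕ) m →
    ∃ λ N → ∀ {y} → L y → r y <ⁿ m → ∃ λ x → L x × x ≤ⁿ N × r x ≡ r y
  representatives r zero = 0 , λ _ ()
  representatives r (suc m) with representatives r m | em {∃ λ x → L x × r x ≡ m}
  ... | N , rep | no none = N , λ {y} Ly ry< →
        rep Ly (ℕ.≤∧≢⇒< (ℕ.s≤s⁻¹ ry<) λ eq → none (y , Ly , eq))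
  ... | N , rep | yes (x , Lx , rx≡m) = N ⊔ x , found
    where
    found : ∀ {y} → L y → r y <ⁿ suc m → ∃ λ x′ → L x′ × x′ ≤ⁿ N ⊔ x × r x′ ≡ r y
    found {y} Ly ry< with r y ℕ.≟ m
    ... | yes ry≡m = x , Lx , ℕ.m≤n⊔m N x , trans rx≡m (sym ry≡m)
    ... | no  ry≢m with rep Ly (ℕ.≤∧≢⇒< (ℕ.s≤s⁻¹ ry<) ry≢m)
    ...   | x′ , Lx′ , x′≤N , eq = x′ , Lx′ , ℕ.≤-trans x′≤N (ℕ.m≤m⊔n N x) , eq

  -- The last condition limits the number of pieces, hence of lost arcs, to `y / q`.
  Splits : ℕ → ℕ → ℕ → Set
  Splits q N y = ∃ λ ks → All (λ k → L k × k ≤ⁿ N) ks × sum ks ≡ y × length ks *ⁿ q ≤ⁿ y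

  -- Modulo `d` there are finitely many classes, so one threshold above `d` and all representatives
  -- serves every `y`.
  split-threshold : ∀ q → ∃ λ N → ∀ {y} → L y → N <ⁿ y → Splits q N y
  split-threshold q with em {∃ λ d → L d × 2 *ⁿ q ≤ⁿ d}
  -- All of `L` lies below `2 *ⁿ q`, so no length exceeds the threshold.
  ... | no none = 2 *ⁿ q , λ {y} Ly 2q<y → contradiction (y , Ly , ℕ.<⇒≤ 2q<y) none
  -- Split off so that `d` is visibly nonzero for `_%_`.
  ... | yes (zero , L0 , _) = contradiction (L≥2 L0) λ ()
  ... | yes (d@(suc _) , Ld , 2q≤d) with representatives (_% d) d
  ...   | N , rep = N ⊔ d , split
    where
    split : ∀ {y} → L y → N ⊔ d <ⁿ y → Splits q (N ⊔ d) y
    split {y} Ly N⊔d<y with rep Ly (m%n<n y d)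
    ... | x , Lx , x≤N , eq
      with congruent⇒+-multiple d (ℕ.≤-trans (ℕ.m≤n⇒m≤n⊔o d x≤N) (ℕ.<⇒≤ N⊔d<y)) eq
    ...   | j , x+jd≡y = x ∷ replicate j d
      , (Lx , ℕ.m≤n⇒m≤n⊔o d x≤N) ∷ All.replicate⁺ j (Ld , ℕ.m≤n⊔m N d)
      , trans (cong (x ℕ.+_) (sum-replicate j d)) x+jd≡y
      -- There are `j + 1` pieces. After doubling, `2 *ⁿ q ≤ⁿ d` reduces the claim to `d` and
      -- `j *ⁿ d` each being at most `y`.
      , subst (λ l → suc l *ⁿ q ≤ⁿ y) (sym (length-replicate j)) (ℕ.*-cancelˡ-≤ 2 (begin
          2 *ⁿ (suc j *ⁿ q)   ≡⟨ *.x∙yz≈y∙xz 2 (suc j) q ⟩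
          suc j *ⁿ (2 *ⁿ q)   ≤⟨ ℕ.*-monoʳ-≤ (suc j) 2q≤d ⟩
          d + j *ⁿ d          ≤⟨ ℕ.+-mono-≤ (ℕ.≤-trans (ℕ.m≤n⊔m N d) (ℕ.<⇒≤ N⊔d<y))
                                   (ℕ.≤-trans (ℕ.m≤n+m _ x) (ℕ.≤-reflexive x+jd≡y)) ⟩
          y + y               ≡⟨ cong (y ℕ.+_) (ℕ.+-identityʳ y) ⟨
          2 *ⁿ y              ∎))
      where
      open ℕ.≤-Reasoning

  module _ (q : ℕ) where

    bound : ℕ
    bound = proj₁ (split-threshold q)

    -- All of `L` up to `bound`, not just the representatives, so that shorter cycles stay whole.
    -- `upTo` excludes its end, hence `suc`.
    truncated : List ℕ
    truncated = filter (λ k → em {L k}) (upTo (suc bound))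

    L′ : Pred ℕ 0ℓ
    L′ = _∈ truncated

    L′⊆L : L′ ⊆ L
    L′⊆L k∈ = proj₂ (∈-filter⁻ (λ k → em {L k}) {xs = upTo (suc bound)} k∈)

    L′⁺ : ∀ {k} → L k × k ≤ⁿ bound → L′ k
    L′⁺ (Lk , k≤) = ∈-filter⁺ (λ k → em {L k}) (∈-upTo⁺ (s≤s k≤)) Lk

    L′-split : ∀ {y} → L y → L′ y ⊎ ∃ λ ks → All L′ ks × sum ks ≡ y × length ks *ⁿ q ≤ⁿ y
    L′-split {y} Ly with y ℕ.≤? bound
    ... | yes y≤ = inj₁ (L′⁺ (Ly , y≤))
    ... | no  y≰ with proj₂ (split-threshold q) Ly (ℕ.≰⇒> y≰)
    ...   | ks , Lks , rest = inj₂ (ks , All.map L′⁺ Lks , rest)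

    expand : ∀ {ls} → All L ls → ∃ λ ks → All L′ ks × sum ks ≡ sum ls
    expand [] = [] , [] , refl
    expand (Ly ∷ Lls) with L′-split Ly | expand Lls
    ... | inj₁ L′y                  | ks′ , L′ks′ , eq′ = _ ∷ ks′ , L′y ∷ L′ks′ , cong (_ ℕ.+_) eq′
    ... | inj₂ (ks , L′ks , eq , _) | ks′ , L′ks′ , eq′ =
      ks ++ ks′ , All.++⁺ L′ks L′ks′ , trans (sum-++ ks ks′) (cong₂ _+_ eq eq′)

    ⟨L′⟩≐⟨L⟩ : ⟨ L′ ⟩ ≐ ⟨ L ⟩
    ⟨L′⟩≐⟨L⟩ = (λ (ks , ks≢[] , L′ks , eq) → ks , ks≢[] , All.map L′⊆L L′ks , eq) , back
      where
      back : ⟨ L ⟩ ⊆ ⟨ L′ ⟩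
      back ([]     , ls≢[] , _ , _) = contradiction refl ls≢[]
      back (l ∷ ls , _ , Ll ∷ Lls , eq) with expand (Ll ∷ Lls)
      ... | k ∷ ks , L′ks , eq′ = k ∷ ks , (λ ()) , L′ks , trans eq′ eq
      -- An empty expansion would have sum 0, while `l` is at least 2.
      ... | []     , _    , eq′ = contradiction (ℕ.≤-trans (L≥2 Ll) (ℕ.≤-trans (ℕ.m≤m+n l _) (ℕ.≤-reflexive (sym eq′)))) λ ()

    -- The inequality says without division that at most a fraction `1 / q` is lost: `cut-cycle`
    -- loses at most `length ks / p` of the weight, and `length ks *ⁿ q ≤ⁿ p`.
    refine-cycle : ∀ (w : A → A → ℕ) c → L (length (toList c)) →
      ∃ λ ds → vertices ds ↭ toList c × All (L′ ∘ length ∘ toList) ds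
        × q *ⁿ cycleWeight w c ≤ⁿ q *ⁿ weight w ds + cycleWeight w c
    refine-cycle {A} w c Lc = [ whole , split ]′ (L′-split Lc)
      where
      open ℕ.≤-Reasoning
      p = length (toList c)
      W = cycleWeight w c
      Refinement = ∃ λ ds → vertices ds ↭ toList c × All (L′ ∘ length ∘ toList) ds
                     × q *ⁿ W ≤ⁿ q *ⁿ weight w ds + W
      whole : L′ p → Refinement
      whole L′c = c ∷ [] , ↭-reflexive (++-identityʳ (toList c)) , L′c ∷ [] ,
        subst (λ V → q *ⁿ W ≤ⁿ q *ⁿ V + W)
              (trans (sym (ℕ.+-identityʳ _)) (sym (weight-∷ w c []))) (ℕ.m≤m+n _ _)
      split : (∃ λ ks → All L′ ks × sum ks ≡ p × length ks *ⁿ q ≤ⁿ p) → Refinement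
      split (ks , L′ks , sum≡ , kq≤) =
        let ds , perm , lens , le = cut-cycle w c (All.map (ℕ.<⇒≤ ∘ L≥2 ∘ L′⊆L) L′ks) sum≡ in
        ds , perm , All.map⁻ (subst (All L′) (sym lens) L′ks) , ℕ.*-cancelˡ-≤ p (begin
        p *ⁿ (q *ⁿ W)                            ≡⟨ *.x∙yz≈y∙xz p q W ⟩
        q *ⁿ (p *ⁿ W)                            ≤⟨ ℕ.*-monoʳ-≤ q le ⟩
        q *ⁿ (p *ⁿ weight w ds + length ks *ⁿ W) ≡⟨ ℕ.*-distribˡ-+ q (p *ⁿ weight w ds) _ ⟩
        q *ⁿ (p *ⁿ weight w ds) + q *ⁿ (length ks *ⁿ W)
          ≡⟨ cong₂ _+_ (*.x∙yz≈y∙xz q p _) (*.x∙yz≈yx∙z q (length ks) W) ⟩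
        p *ⁿ (q *ⁿ weight w ds) + length ks *ⁿ q *ⁿ W
          ≤⟨ ℕ.+-monoʳ-≤ (p *ⁿ (q *ⁿ weight w ds)) (ℕ.*-monoˡ-≤ W kq≤) ⟩
        p *ⁿ (q *ⁿ weight w ds) + p *ⁿ W         ≡⟨ ℕ.*-distribˡ-+ p (q *ⁿ weight w ds) W ⟨
        p *ⁿ (q *ⁿ weight w ds + W)              ∎)

    refine : ∀ (w : A → A → ℕ) {cs} → All (L ∘ length ∘ toList) cs →
      ∃ λ ds → vertices ds ↭ vertices cs × All (L′ ∘ length ∘ toList) ds
        × q *ⁿ weight w cs ≤ⁿ q *ⁿ weight w ds + weight w cs
    refine w [] = [] , ↭-refl , [] , ℕ.m≤m+n _ _
    refine w {c ∷ cs} (Lc ∷ Lcs) with refine-cycle w c Lc | refine w Lcs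
    ... | ds , perm , L′ds , le | es , perm′ , L′es , le′ =
      ds ++ es
      , ↭-trans (↭-reflexive (concatMap-++ toList ds es)) (↭.++⁺ perm perm′)
      , All.++⁺ L′ds L′es
      , (begin
        q *ⁿ weight w (c ∷ cs)
          ≡⟨ cong (q *ⁿ_) (weight-∷ w c cs) ⟩
        q *ⁿ (cycleWeight w c + weight w cs)
          ≡⟨ ℕ.*-distribˡ-+ q (cycleWeight w c) _ ⟩
        q *ⁿ cycleWeight w c + q *ⁿ weight w cs
          ≤⟨ ℕ.+-mono-≤ le le′ ⟩
        q *ⁿ weight w ds + cycleWeight w c + (q *ⁿ weight w es + weight w cs)
          ≡⟨ +.interchange (q *ⁿ weight w ds) _ _ _ ⟩
        q *ⁿ weight w ds + q *ⁿ weight w es + (cycleWeight w c + weight w cs)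
          ≡⟨ cong₂ _+_ (ℕ.*-distribˡ-+ q (weight w ds) _) (weight-∷ w c cs) ⟨
        q *ⁿ (weight w ds + weight w es) + weight w (c ∷ cs)
          ≡⟨ cong (λ W → q *ⁿ W + weight w (c ∷ cs)) (weight-++ w ds es) ⟨
        q *ⁿ weight w (ds ++ es) + weight w (c ∷ cs)
          ∎)
      where
      open ℕ.≤-Reasoning

-- Existence of covers and comparison of the maxima

-- One cycle through all vertices is cut into pieces of the given lengths, with constant weight 0.
lCycles-exist : ∀ {L} → L ⊆ (2 ≤ⁿ_) → ∀ n → ⟨ L ⟩ n → ∃ (LCycles L n)
lCycles-exist L≥2 n ([] , ls≢[] , _ , _) = contradiction refl ls≢[]
lCycles-exist L≥2 zero (l ∷ ls , _ , Ll ∷ _ , eq) =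
  contradiction (ℕ.≤-trans (L≥2 Ll) (ℕ.≤-trans (ℕ.m≤m+n l _) (ℕ.≤-reflexive eq))) λ ()
lCycles-exist {L} L≥2 (suc n) (ls@(_ ∷ _) , _ , Lls , eq) =
  let ds , perm , lens , _ = cut-cycle (λ _ _ → 0) (zero ∷ List.tabulate suc) (All.map (ℕ.<⇒≤ ∘ L≥2) Lls)
                               (trans eq (cong suc (sym (length-tabulate {n = n} suc))))
  in ds , perm , All.map⁻ (subst (All L) (sym lens) Lls)

-- Written for m − m / q ≤ m′ without subtraction; any ε > 0 is at least 1 / ↧ₙ ε.

≥-scaled : ∀ ε → 0ℚ < ε → ∀ m m′ → ℚ.↧ₙ ε *ⁿ m ≤ⁿ ℚ.↧ₙ ε *ⁿ m′ + m →
           (+ m′ / 1) ≥ (1ℚ - ε) * (+ m / 1)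
≥-scaled (ℚ.mkℚ (+ zero)      d _) (ℚ.*<* (ℤ.+<+ ())) m m′ le
≥-scaled (ℚ.mkℚ (ℤ.-[1+ _ ])  d _) (ℚ.*<* ())         m m′ le
≥-scaled ε@(ℚ.mkℚ (+ suc a) d-1 _) _ m m′ le = ℚ.toℚᵘ-cancel-≤ (begin
  ℚ.toℚᵘ ((1ℚ - ε) * (+ m / 1))                  ≃⟨ ℚ.toℚᵘ-homo-* (1ℚ - ε) (+ m / 1) ⟩
  ℚ.toℚᵘ (1ℚ - ε) ℚᵘ.* ℚ.toℚᵘ (+ m / 1)
    ≃⟨ ℚᵘ.*-cong
         (ℚᵘ.≃-trans (ℚ.toℚᵘ-homo-+ 1ℚ (ℚ.- ε)) (ℚᵘ.+-congʳ ℚᵘ.1ℚᵘ (ℚ.toℚᵘ-homo‿- ε)))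
         (ℚ.toℚᵘ-fromℚᵘ (ℚᵘ.mkℚᵘ (+ m) 0)) ⟩
  (ℚᵘ.1ℚᵘ ℚᵘ.- ℚᵘ.mkℚᵘ (+ suc a) d-1) ℚᵘ.* ℚᵘ.mkℚᵘ (+ m) 0
    ≤⟨ ℚᵘ.*≤* integral ⟩
  ℚᵘ.mkℚᵘ (+ m′) 0                               ≃⟨ ℚ.toℚᵘ-fromℚᵘ (ℚᵘ.mkℚᵘ (+ m′) 0) ⟨
  ℚ.toℚᵘ (+ m′ / 1)                              ∎)
  where
  open ℚᵘ.≤-Reasoning
  q = suc d-1
  simplify : ∀ i j k → (+ 1 ℤ.* i ℤ.+ (ℤ.- j) ℤ.* + 1) ℤ.* k ℤ.* + 1 ≡ i ℤ.* k ℤ.- j ℤ.* k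
  simplify = solve-∀
  cancel : ∀ i j k → i ℤ.* j ℤ.+ k ℤ.- k ≡ j ℤ.* i
  cancel = solve-∀
  -- The numerator of `ε` is at least 1, so the error term `m` may grow to `suc a *ⁿ m`.
  le′ : q *ⁿ m ≤ⁿ q *ⁿ m′ + suc a *ⁿ m
  le′ = ℕ.≤-trans le (ℕ.+-monoʳ-≤ (q *ⁿ m′) (ℕ.m≤m+n m (a *ⁿ m)))
  leℤ : + q ℤ.* + m ℤ.≤ + q ℤ.* + m′ ℤ.+ + suc a ℤ.* + m
  leℤ = subst₂ ℤ._≤_ (ℤ.pos-* q m) (trans (ℤ.pos-+ (q *ⁿ m′) (suc a *ⁿ m)) (cong₂ ℤ._+_ (ℤ.pos-* q m′) (ℤ.pos-* (suc a) m)))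
               (ℤ.+≤+ le′)
  -- The right-hand side is the denominator that unnormalised arithmetic computes for the product.
  denominator : q ≡ suc ((d-1 + 0) *ⁿ 1)
  denominator = cong suc (sym (trans (ℕ.*-identityʳ (d-1 + 0)) (ℕ.+-identityʳ d-1)))
  integral : (+ 1 ℤ.* + q ℤ.+ (ℤ.- + suc a) ℤ.* + 1) ℤ.* + m ℤ.* + 1
               ℤ.≤ + m′ ℤ.* + suc ((d-1 + 0) *ⁿ 1)
  integral = subst₂ ℤ._≤_ (sym (simplify (+ q) (+ suc a) (+ m)))
    (trans (cancel (+ q) (+ m′) (+ suc a ℤ.* + m)) (cong (λ d → + m′ ℤ.* + d) denominator))
    (ℤ.+-monoˡ-≤ (ℤ.- (+ suc a ℤ.* + m)) leℤ)

directedCover : ∀ {L} → L ⊆ (2 ≤ⁿ_) → (w : Weights n) → ∀ {cs} → LCycles L n cs →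
  ∃ λ C → IsDirectedLCycleCover C L × directedWeight C w ≡ weight w cs
directedCover L≥2 w cycles = edges , isCover , directedWeight-edges w
  where open DirectedCover L≥2 cycles

undirectedCover : ∀ {L} → L ⊆ (3 ≤ⁿ_) → {w : Weights n} → (∀ u v → w u v ≡ w v u) →
  ∀ {cs} → LCycles L n cs →
  ∃ λ C → IsUndirectedLCycleCover C L × undirectedWeight C w ≡ weight w cs
undirectedCover L≥3 w-sym cycles = edges , isCover , undirectedWeight-edges w-sym
  where open UndirectedCover L≥3 cycles

module Approximation (em : ExcludedMiddle 0ℓ) (L : Pred ℕ 0ℓ) (L≥2 : L ⊆ (2 ≤ⁿ_)) (ε : ℚ) (ε>0 : 0ℚ < ε) where

  open Truncation em L L≥2

  q : ℕ
  q = ℚ.↧ₙ ε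

  -- P and P′ are the L- and L′-cycle covers, directed or undirected, and f is their weight.

  maxima : ∀ {n} (w : Weights n) (P P′ : Pred (EdgeSet n) 0ℓ) (f : EdgeSet n → ℕ) b → (∀ C → f C ≤ⁿ b) →
    (∀ {C} → P C → ∃ λ cs → LCycles L n cs × f C ≡ weight w cs) →
    (∀ {cs} → LCycles L n cs → ∃ λ C → P C × f C ≡ weight w cs) →
    (∀ {cs} → LCycles (L′ q) n cs → ∃ λ C → P′ C × f C ≡ weight w cs) →
    ⟨ L ⟩ n →
    ∃₂ λ m m′ → IsMaximum P f m × IsMaximum P′ f m′ × (+ m′ / 1) ≥ (1ℚ - ε) * (+ m / 1)
  maxima {n} w P P′ f b f≤b to from from′ n∈ =
    compare (max-exists em f sat b (λ C _ → f≤b C)) (max-exists em f sat′ b (λ C _ → f≤b C))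
    where
    Refinement : List (List⁺ (Fin n)) → Set
    Refinement cs = ∃ λ ds → LCycles (L′ q) n ds × q *ⁿ weight w cs ≤ⁿ q *ⁿ weight w ds + weight w cs
    refinement : ∀ {cs} → LCycles L n cs → Refinement cs
    refinement (perm , Lcs) =
      let ds , perm′ , L′ds , le = refine q w Lcs in ds , (↭-trans perm′ perm , L′ds) , le
    cycles : ∃ (LCycles L n)
    cycles = lCycles-exist L≥2 n n∈
    sat : Satisfiable P
    sat = let C , pC , _ = from (proj₂ cycles) in C , pC
    sat′ : Satisfiable P′
    sat′ = let C , pC , _ = from′ (proj₁ (proj₂ (refinement (proj₂ cycles)))) in C , pC
    scaled : ∀ {m m′ cs} → IsMaximum P′ f m′ → m ≡ weight w cs → Refinement cs →
             q *ⁿ m ≤ⁿ q *ⁿ m′ + m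
    scaled {m} {m′} (_ , best) refl (ds , L′ds , le) =
      -- The refined cycles form an `L′`-cover, so their weight is at most `m′`.
      let C , pC , eq = from′ L′ds
      in ℕ.≤-trans le (ℕ.+-monoˡ-≤ m (ℕ.*-monoʳ-≤ q (subst (_≤ⁿ m′) eq (best C pC))))
    compare : ∃ (IsMaximum P f) → ∃ (IsMaximum P′ f) →
      ∃₂ λ m m′ → IsMaximum P f m × IsMaximum P′ f m′ × (+ m′ / 1) ≥ (1ℚ - ε) * (+ m / 1)
    compare (m , max@((C , pC , fC≡m) , _)) (m′ , max′) =
      let cs , cycs , eq = to pC
      in m , m′ , max , max′
         , ≥-scaled ε ε>0 m m′ (scaled {cs = cs} max′ (trans (sym fC≡m) eq) (refinement cycs))

  directed : ∀ n → ⟨ L ⟩ n → (w : Weights n) →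
    ∃₂ λ m m′ → IsDirectedMax L n w m × IsDirectedMax (L′ q) n w m′
      × (+ m′ / 1) ≥ (1ℚ - ε) * (+ m / 1)
  directed n n∈ w = maxima w _ _ (λ C → directedWeight C w) _ (λ C → directedWeight-≤ C w)
    (λ cover → let cs , cycs , eq = DirectedCycles.lCycles cover in cs , cycs , eq w)
    (directedCover L≥2 w) (directedCover (L≥2 ∘ L′⊆L q) w)
    n∈

  undirected : L ⊆ (3 ≤ⁿ_) → ∀ n → ⟨ L ⟩ n → (w : Weights n) → (∀ u v → w u v ≡ w v u) →
    ∃₂ λ m m′ → IsUndirectedMax L n w m × IsUndirectedMax (L′ q) n w m′
      × (+ m′ / 1) ≥ (1ℚ - ε) * (+ m / 1)
  undirected L≥3 n n∈ w w-sym = maxima w _ _ (λ C → undirectedWeight C w) _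
    (λ C → directedWeight-≤ (λ u v → (toℕ u <ᵇ toℕ v) ∧ C u v) w)
    (λ cover → let cs , cycs , eq = UndirectedCycles.lCycles cover in cs , cycs , eq w-sym)
    (undirectedCover L≥3 w-sym) (undirectedCover (L≥3 ∘ L′⊆L q) w-sym)
    n∈

theorem4p1 : ExcludedMiddle 0ℓ →
    (L : Pred ℕ 0ℓ) → L ⊆ (2 ≤ⁿ_) → Satisfiable L →
    (ε : ℚ) → 0ℚ < ε →
    ∃ λ (xs : List ℕ) → let L′ = _∈ xs in
    L′ ⊆ L × ⟨ L′ ⟩ ≐ ⟨ L ⟩
    × (∀ n → ⟨ L ⟩ n → (w : Weights n) →
    ∃₂ λ m m′ → IsDirectedMax L n w m × IsDirectedMax L′ n w m′
    × (+ m′ / 1) ≥ (1ℚ - ε) * (+ m / 1))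
    × (L ⊆ (3 ≤ⁿ_) →
    ∀ n → ⟨ L ⟩ n → (w : Weights n) → (∀ u v → w u v ≡ w v u) →
    ∃₂ λ m m′ → IsUndirectedMax L n w m × IsUndirectedMax L′ n w m′
    × (+ m′ / 1) ≥ (1ℚ - ε) * (+ m / 1))
theorem4p1 em L L≥2 _ ε ε>0 =
  truncated q , L′⊆L q , ⟨L′⟩≐⟨L⟩ q , directed , undirected
  where
  open Truncation em L L≥2
  open Approximation em L L≥2 ε ε>0
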